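{- For $k>0$ we have the identity $$\zeta_{\mathcal P}(\{4\}^k)=\sum_{\ell(\lambda)=k}\frac1{n_\lambda^4}=\frac{1}{16^{k-1}}\left(\sum_{n=0}^{2k}(-1)^n\left(2^{2n-1}-1\right)\left(2^{4k-2n-1}-1\right)\zeta(2n)\,\zeta(4k-2n)\right),$$ and increasingly complicated formulas can be computed for $\zeta_{\mathcal P}(\{2^t\}^k)$, $t\in\mathbb Z^+$.
   Context: A partition is a finite non-increasing sequence $\lambda=(\lambda_1,\dots,\lambda_r)$ of positive integers (including the empty partition $\emptyset$, $r=0$); its length is $\ell(\lambda):=r$ and its integer is $n_\lambda:=\lambda_1\lambda_2\cdots\lambda_r$ (with $n_\emptyset:=1$). For $s\in\mathbb C$ with $\operatorname{Re}(s)>1$ and an integer $k\ge0$, $\zeta_{\mathcal P}(\{s\}^k):=\sum_{\ell(\lambda)=k}n_\lambda^{ -s}$, the sum being over all partitions of length exactly $k$. Here $k$ is an integer, $\mathbb Z^+$ is the set of positive integers, and $\zeta$ is the Riemann zeta function, with $\zeta(0)=-1/2$ by analytic continuation. -}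

module Defs where

open import Algebra.Definitions.RawSemiring using (_^_)
open import Data.Integer.Base as ℤ using (ℤ; +_; -[1+_])
import Data.Integer.Properties as ℤ
open import Data.List.Base using (List; []; _∷_; map; foldr; applyUpTo; length)
open import Data.List.Relation.Binary.Subset.Propositional using (_⊆_)
open import Data.List.Relation.Unary.All using (All)
open import Data.List.Relation.Unary.Linked using (Linked)
open import Data.List.Relation.Unary.Unique.Propositional using (Unique)
open import Data.Nat.Base as ℕ using (ℕ; zero; suc; NonZero)
open import Data.Nat.ListAction using (product)
open import Data.Nat.ListAction.Properties using (product≢0)
import Data.Nat.Properties as ℕ
open import Data.Product.Base using (Σ-syntax; ∃-syntax; _×_; _,_; proj₁)
open import Data.Rational.Base as ℚ hiding (NonZero; nonNegative)
open import Data.Rational.Properties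
open import Data.Rational.Solver using (module +-*-Solver)
open import Data.Rational.Unnormalised.Base as ℚᵘ using (mkℚᵘ; *≤*; *<*)
import Data.Rational.Unnormalised.Properties as ℚᵘ
open import Data.Sum.Base using (_⊎_; inj₁; inj₂)
open import Relation.Binary.PropositionalEquality

-- Real numbers are Cauchy sequences of rationals, taken without quotienting:
-- HasSum below depends on the limit alone.
record ℝ : Set where
  constructor mkℝ
  field
    seq      : ℕ → ℚ
    isCauchy : ∀ ε → 0ℚ < ε → ∃[ N ] ∀ m n → N ℕ.≤ m → N ℕ.≤ n → ∣ seq m - seq n ∣ < ε

open ℝ public

fromℚ : ℚ → ℝ
fromℚ q = mkℝ (λ _ → q) λ ε 0<ε → 0 , λ _ _ _ _ →
  subst (_< ε) (sym (cong ∣_∣ (+-inverseʳ q))) 0<ε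

half-pos : ∀ {ε} → 0ℚ < ε → 0ℚ < ½ * ε
half-pos {ε} 0<ε = subst (_< ½ * ε) (*-zeroʳ ½) (*-monoʳ-<-pos ½ 0<ε)

half+half : ∀ ε → ½ * ε + ½ * ε ≡ ε
half+half ε = trans (sym (*-distribʳ-+ ε ½ ½)) (*-identityˡ ε)

add-lemma : ∀ a b c d → (a + b) - (c + d) ≡ (a - c) + (b - d)
add-lemma = solve 4 (λ a b c d → (a :+ b) :- (c :+ d) := (a :- c) :+ (b :- d)) refl
  where open +-*-Solver

mul-lemma : ∀ a b c d → a * b - c * d ≡ a * (b - d) + d * (a - c)
mul-lemma = solve 4 (λ a b c d → a :* b :- c :* d := a :* (b :- d) :+ d :* (a :- c)) refl
  where open +-*-Solver

sub-add : ∀ a b → a ≡ (a - b) + b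
sub-add = solve 2 (λ a b → a := (a :- b) :+ b) refl
  where open +-*-Solver

∣+∣<ε : ∀ {ε} a b → ∣ a ∣ < ½ * ε → ∣ b ∣ < ½ * ε → ∣ a + b ∣ < ε
∣+∣<ε {ε} a b ∣a∣< ∣b∣< = ≤-<-trans (∣p+q∣≤∣p∣+∣q∣ a b)
  (subst (∣ a ∣ + ∣ b ∣ <_) (half+half ε) (+-mono-< ∣a∣< ∣b∣<))

bounded : (x : ℝ) → Σ[ B ∈ ℚ ] Positive B × (∃[ N ] ∀ n → N ℕ.≤ n → ∣ seq x n ∣ ≤ B)
bounded x with isCauchy x 1ℚ (positive⁻¹ 1ℚ)
... | N , close = 1ℚ + ∣ seq x N ∣
                , pos+nonNeg⇒pos 1ℚ ∣ seq x N ∣ {{∣-∣-nonNeg (seq x N)}}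
                , N , λ n N≤n → begin
  ∣ seq x n ∣                            ≡⟨ cong ∣_∣ (sub-add (seq x n) (seq x N)) ⟩
  ∣ (seq x n - seq x N) + seq x N ∣      ≤⟨ ∣p+q∣≤∣p∣+∣q∣ (seq x n - seq x N) (seq x N) ⟩
  ∣ seq x n - seq x N ∣ + ∣ seq x N ∣    ≤⟨ +-monoˡ-≤ ∣ seq x N ∣ (<⇒≤ (close n N N≤n ℕ.≤-refl)) ⟩
  1ℚ + ∣ seq x N ∣                       ∎
  where open ≤-Reasoning

scaled : ∀ B ε → Positive B → 0ℚ < ε → Σ[ δ ∈ ℚ ] 0ℚ < δ ×
         (∀ a b → ∣ a ∣ ≤ B → ∣ b ∣ < δ → ∣ a * b ∣ < ε)
scaled B ε B>0 0<ε = δ , positive⁻¹ δ {{δ>0}} , λ a b ∣a∣≤B ∣b∣<δ → begin-strict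
  ∣ a * b ∣        ≡⟨ ∣p*q∣≡∣p∣*∣q∣ a b ⟩
  ∣ a ∣ * ∣ b ∣    ≤⟨ *-monoʳ-≤-nonNeg ∣ b ∣ {{∣-∣-nonNeg b}} ∣a∣≤B ⟩
  B * ∣ b ∣        <⟨ *-monoʳ-<-pos B {{B>0}} ∣b∣<δ ⟩
  B * (1/B * ε)    ≡⟨ sym (*-assoc B 1/B ε) ⟩
  (B * 1/B) * ε    ≡⟨ cong (_* ε) (*-inverseʳ B {{B≢0}}) ⟩
  1ℚ * ε           ≡⟨ *-identityˡ ε ⟩
  ε                ∎
  where
    open ≤-Reasoning
    B≢0 = pos⇒nonZero B {{B>0}}
    1/B = (1/ B) {{B≢0}}
    δ   = 1/B * ε
    δ>0 = pos*pos⇒pos 1/B {{1/pos⇒pos B {{B>0}}}} ε {{positive 0<ε}}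

infixl 6 _+ᴿ_
infixl 7 _*ᴿ_

_+ᴿ_ : ℝ → ℝ → ℝ
x +ᴿ y = mkℝ (λ n → seq x n + seq y n) λ ε 0<ε →
  let (M , p) = isCauchy x (½ * ε) (half-pos 0<ε)
      (N , q) = isCauchy y (½ * ε) (half-pos 0<ε)
  in M ℕ.⊔ N , λ m n M⊔N≤m M⊔N≤n →
     subst (λ z → ∣ z ∣ < ε) (sym (add-lemma (seq x m) (seq y m) (seq x n) (seq y n)))
       (∣+∣<ε (seq x m - seq x n) (seq y m - seq y n)
         (p m n (ℕ.m⊔n≤o⇒m≤o M N M⊔N≤m) (ℕ.m⊔n≤o⇒m≤o M N M⊔N≤n))
         (q m n (ℕ.m⊔n≤o⇒n≤o M N M⊔N≤m) (ℕ.m⊔n≤o⇒n≤o M N M⊔N≤n)))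

_*ᴿ_ : ℝ → ℝ → ℝ
x *ᴿ y = mkℝ (λ n → seq x n * seq y n) λ ε 0<ε →
  let (B , B>0 , K , x≤B) = bounded x
      (C , C>0 , L , y≤C) = bounded y
      (δ , 0<δ , f)       = scaled B (½ * ε) B>0 (half-pos 0<ε)
      (η , 0<η , g)       = scaled C (½ * ε) C>0 (half-pos 0<ε)
      (M , p)             = isCauchy y δ 0<δ
      (N , q)             = isCauchy x η 0<η
      R                   = (K ℕ.⊔ L) ℕ.⊔ (M ℕ.⊔ N)
      K≤ = λ {i} (R≤i : R ℕ.≤ i) → ℕ.m⊔n≤o⇒m≤o K L (ℕ.m⊔n≤o⇒m≤o (K ℕ.⊔ L) (M ℕ.⊔ N) R≤i)
      L≤ = λ {i} (R≤i : R ℕ.≤ i) → ℕ.m⊔n≤o⇒n≤o K L (ℕ.m⊔n≤o⇒m≤o (K ℕ.⊔ L) (M ℕ.⊔ N) R≤i)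
      M≤ = λ {i} (R≤i : R ℕ.≤ i) → ℕ.m⊔n≤o⇒m≤o M N (ℕ.m⊔n≤o⇒n≤o (K ℕ.⊔ L) (M ℕ.⊔ N) R≤i)
      N≤ = λ {i} (R≤i : R ℕ.≤ i) → ℕ.m⊔n≤o⇒n≤o M N (ℕ.m⊔n≤o⇒n≤o (K ℕ.⊔ L) (M ℕ.⊔ N) R≤i)
  in R , λ m n R≤m R≤n →
     subst (λ z → ∣ z ∣ < ε) (sym (mul-lemma (seq x m) (seq y m) (seq x n) (seq y n)))
       (∣+∣<ε (seq x m * (seq y m - seq y n)) (seq y n * (seq x m - seq x n))
         (f (seq x m) (seq y m - seq y n) (x≤B m (K≤ R≤m)) (p m n (M≤ R≤m) (M≤ R≤n)))
         (g (seq y n) (seq x m - seq x n) (y≤C n (L≤ R≤n)) (q m n (N≤ R≤m) (N≤ R≤n))))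

Σᴿ[_⋯_]_ : ℕ → ℕ → (ℕ → ℝ) → ℝ
Σᴿ[ a ⋯ b ] f = foldr _+ᴿ_ (fromℚ 0ℚ) (applyUpTo (λ i → f (a ℕ.+ i)) (suc b ℕ.∸ a))

-- Only eventual closeness of the approximations is asked for.  For a single ε
-- this is finer than ∣ q − x ∣ ≤ ε on reals, but the two agree once ε ranges
-- over all positive rationals.
∣_-_∣≤_ : ℚ → ℝ → ℚ → Set
∣ q - x ∣≤ ε = ∃[ N ] ∀ n → N ℕ.≤ n → ∣ q - seq x n ∣ ≤ ε

-- The family f is (unconditionally) summable with sum x: the net of its sums
-- over finite subsets of I, here duplicate-free lists, converges to x.
HasSum : {I : Set} → (I → ℚ) → ℝ → Set
HasSum {I} f x = ∀ ε → 0ℚ < ε → Σ[ S ∈ List I ]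
  ∀ T → Unique T → S ⊆ T → ∣ foldr _+_ 0ℚ (map f T) - x ∣≤ ε

1/_^ℕ_ : (n s : ℕ) .{{_ : NonZero n}} → ℚ
1/ n ^ℕ s = (+ 1 / (n ℕ.^ s)) {{ℕ.m^n≢0 n s}}

partialζ : ℕ → ℕ → ℚ
partialζ s zero    = 0ℚ
partialζ s (suc n) = partialζ s n + 1/ suc n ^ℕ s

toℚᵘ-/ : ∀ i n → toℚᵘ (i / suc n) ℚᵘ.≃ mkℚᵘ i n
toℚᵘ-/ i n = toℚᵘ-fromℚᵘ (mkℚᵘ i n)

1/a+1/b≤1/c : ∀ a b c → (suc b ℕ.+ suc a) ℕ.* suc c ℕ.≤ suc a ℕ.* suc b →
              (+ 1 / suc a) + (+ 1 / suc b) ≤ + 1 / suc c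
1/a+1/b≤1/c a b c h = toℚᵘ-cancel-≤ (begin
  toℚᵘ ((+ 1 / suc a) + (+ 1 / suc b))              ≃⟨ toℚᵘ-homo-+ (+ 1 / suc a) (+ 1 / suc b) ⟩
  toℚᵘ (+ 1 / suc a) ℚᵘ.+ toℚᵘ (+ 1 / suc b)        ≃⟨ ℚᵘ.+-cong (toℚᵘ-/ (+ 1) a) (toℚᵘ-/ (+ 1) b) ⟩
  mkℚᵘ (+ 1) a ℚᵘ.+ mkℚᵘ (+ 1) b                    ≤⟨ *≤* (subst₂ ℤ._≤_ eqˡ (sym (ℤ.*-identityˡ _)) (ℤ.+≤+ h)) ⟩
  mkℚᵘ (+ 1) c                                      ≃⟨ ℚᵘ.≃-sym (toℚᵘ-/ (+ 1) c) ⟩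
  toℚᵘ (+ 1 / suc c)                                ∎)
  where
    open ℚᵘ.≤-Reasoning
    eqˡ : + ((suc b ℕ.+ suc a) ℕ.* suc c) ≡
          (+ 1 ℤ.* + suc b ℤ.+ + 1 ℤ.* + suc a) ℤ.* + suc c
    eqˡ = trans (ℤ.pos-* (suc b ℕ.+ suc a) (suc c))
                (cong (ℤ._* + suc c)
                  (sym (cong₂ ℤ._+_ (ℤ.*-identityˡ (+ suc b)) (ℤ.*-identityˡ (+ suc a)))))

1/[2+n]^s+1/[2+n]≤1/[1+n] : ∀ s n →
  1/ suc (suc n) ^ℕ suc (suc s) + (+ 1 / suc (suc n)) ≤ + 1 / suc n
1/[2+n]^s+1/[2+n]≤1/[1+n] s n = subst (λ z → z + (+ 1 / suc (suc n)) ≤ + 1 / suc n)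
  (/-cong {+ 1} {suc (ℕ.pred A)} {+ 1} {A} {{_}} {{A≢0}} refl (ℕ.suc-pred A {{A≢0}}))
  (1/a+1/b≤1/c (ℕ.pred A) (suc n) n (subst
    (λ z → (B ℕ.+ z) ℕ.* suc n ℕ.≤ z ℕ.* B) (sym (ℕ.suc-pred A {{A≢0}})) bound))
  where
    B = suc (suc n)
    A = B ℕ.^ suc (suc s)
    A≢0 = ℕ.m^n≢0 B (suc (suc s))
    BC≤A : B ℕ.* suc n ℕ.≤ A
    BC≤A = ℕ.*-monoʳ-≤ B (ℕ.≤-trans (ℕ.n≤1+n (suc n))
             (ℕ.m≤m*n B (B ℕ.^ s) {{ℕ.m^n≢0 B s}}))
    bound : (B ℕ.+ A) ℕ.* suc n ℕ.≤ A ℕ.* B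
    bound = begin
      (B ℕ.+ A) ℕ.* suc n            ≡⟨ ℕ.*-distribʳ-+ (suc n) B A ⟩
      B ℕ.* suc n ℕ.+ A ℕ.* suc n    ≤⟨ ℕ.+-monoˡ-≤ (A ℕ.* suc n) BC≤A ⟩
      A ℕ.+ A ℕ.* suc n              ≡⟨ ℕ.*-suc A (suc n) ⟨
      A ℕ.* B                        ∎
      where open ℕ.≤-Reasoning

1/n^s-nonNeg : ∀ n s → 0ℚ ≤ 1/ suc n ^ℕ s
1/n^s-nonNeg n s = nonNegative⁻¹ _ {{normalize-nonNeg 1 (suc n ℕ.^ s) {{ℕ.m^n≢0 (suc n) s}}}}

partialζ-mono : ∀ s {m n} → m ℕ.≤′ n → partialζ s m ≤ partialζ s n
partialζ-mono s ℕ.≤′-refl            = ≤-refl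
partialζ-mono s (ℕ.≤′-step {n} m≤′n) = ≤-trans (partialζ-mono s m≤′n)
  (subst (_≤ partialζ s (suc n)) (+-identityʳ _) (+-monoʳ-≤ (partialζ s n) (1/n^s-nonNeg n s)))

partialζ-bound : ∀ s {m n} → m ℕ.≤′ n →
  partialζ (suc (suc s)) (suc n) + (+ 1 / suc n) ≤
  partialζ (suc (suc s)) (suc m) + (+ 1 / suc m)
partialζ-bound s ℕ.≤′-refl            = ≤-refl
partialζ-bound s (ℕ.≤′-step {n} m≤′n) = ≤-trans
  (subst (_≤ p + (+ 1 / suc n)) (sym (+-assoc p _ _))
    (+-monoʳ-≤ p (1/[2+n]^s+1/[2+n]≤1/[1+n] s n)))
  (partialζ-bound s m≤′n)
  where p = partialζ (suc (suc s)) (suc n)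

∣b-a∣≤c : ∀ a b c → a ≤ b → b ≤ a + c → ∣ b - a ∣ ≤ c
∣b-a∣≤c a b c a≤b b≤a+c = subst₂ _≤_
  (sym (0≤p⇒∣p∣≡p (subst (_≤ b - a) (+-inverseʳ a) (+-monoˡ-≤ (- a) a≤b))))
  (cancel a c) (+-monoˡ-≤ (- a) b≤a+c)
  where
    cancel : ∀ a c → (a + c) - a ≡ c
    cancel = solve 2 (λ a c → (a :+ c) :- a := c) refl
      where open +-*-Solver

partialζ-close : ∀ s N m n → N ℕ.≤ m → m ℕ.≤ n →
  ∣ partialζ (suc (suc s)) (suc n) - partialζ (suc (suc s)) (suc m) ∣ ≤ + 1 / suc m
partialζ-close s N m n N≤m m≤n = ∣b-a∣≤c _ _ _
  (partialζ-mono (suc (suc s)) (ℕ.≤⇒≤′ (ℕ.s≤s m≤n)))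
  (≤-trans (subst (_≤ q + (+ 1 / suc n)) (+-identityʳ q)
             (+-monoʳ-≤ q (nonNegative⁻¹ _ {{normalize-nonNeg 1 (suc n)}})))
           (partialζ-bound s (ℕ.≤⇒≤′ m≤n)))
  where q = partialζ (suc (suc s)) (suc n)

1/-antimono : ∀ {m n} → m ℕ.≤ n → + 1 / suc n ≤ + 1 / suc m
1/-antimono {m} {n} m≤n = toℚᵘ-cancel-≤ (begin
  toℚᵘ (+ 1 / suc n)    ≃⟨ toℚᵘ-/ (+ 1) n ⟩
  mkℚᵘ (+ 1) n          ≤⟨ *≤* (ℤ.*-monoˡ-≤-nonNeg (+ 1) (ℤ.+≤+ (ℕ.s≤s m≤n))) ⟩
  mkℚᵘ (+ 1) m          ≃⟨ ℚᵘ.≃-sym (toℚᵘ-/ (+ 1) m) ⟩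
  toℚᵘ (+ 1 / suc m)    ∎)
  where open ℚᵘ.≤-Reasoning

archimedean : ∀ ε → 0ℚ < ε → ∃[ N ] + 1 / suc N < ε
archimedean ε@(mkℚ (+ suc p) d _) _ = suc d , toℚᵘ-cancel-< (ℚᵘ.≤-<-trans
  (ℚᵘ.≤-reflexive (toℚᵘ-/ (+ 1) (suc d)))
  (*<* (subst (ℤ._< + suc p ℤ.* + suc (suc d)) (sym (ℤ.*-identityˡ (+ suc d)))
    (ℤ.+<+ (ℕ.≤-trans (ℕ.n<1+n (suc d)) (ℕ.m≤m+n (suc (suc d)) _))))))
archimedean (mkℚ (+ 0) d _) (*<* (ℤ.+<+ ()))
archimedean (mkℚ -[1+ p ] d _) (*<* ())

∣-∣-sym : ∀ a b → ∣ a - b ∣ ≡ ∣ b - a ∣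
∣-∣-sym a b = trans (sym (∣-p∣≡∣p∣ (a - b))) (cong ∣_∣ (flip a b))
  where
    flip : ∀ a b → - (a - b) ≡ b - a
    flip = solve 2 (λ a b → :- (a :- b) := b :- a) refl
      where open +-*-Solver

partialζ-cauchy : ∀ s ε → 0ℚ < ε → ∃[ N ] ∀ m n → N ℕ.≤ m → N ℕ.≤ n →
                  ∣ partialζ (suc (suc s)) m - partialζ (suc (suc s)) n ∣ < ε
partialζ-cauchy s ε 0<ε with archimedean ε 0<ε
... | N , 1/N<ε = suc N , close⁺
  where
    close : ∀ m n → N ℕ.≤ m → N ℕ.≤ n → m ℕ.≤ n ⊎ n ℕ.≤ m →
            ∣ partialζ (suc (suc s)) (suc m) - partialζ (suc (suc s)) (suc n) ∣ < ε
    close m n N≤m N≤n (inj₁ m≤n) = subst (_< ε) (∣-∣-sym _ (partialζ (suc (suc s)) (suc m)))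
      (≤-<-trans (partialζ-close s N m n N≤m m≤n) (≤-<-trans (1/-antimono N≤m) 1/N<ε))
    close m n N≤m N≤n (inj₂ n≤m) =
      ≤-<-trans (partialζ-close s N n m N≤n n≤m) (≤-<-trans (1/-antimono N≤n) 1/N<ε)

    close⁺ : ∀ m n → suc N ℕ.≤ m → suc N ℕ.≤ n →
             ∣ partialζ (suc (suc s)) m - partialζ (suc (suc s)) n ∣ < ε
    close⁺ (suc m) (suc n) (ℕ.s≤s N≤m) (ℕ.s≤s N≤n) = close m n N≤m N≤n (ℕ.≤-total m n)

-- ζ(0) is the value of the analytic continuation.  ζ has a pole at 1; the value
-- given there is a dummy.
ζ : ℕ → ℝ
ζ 0             = fromℚ (- ½)
ζ 1             = fromℚ 0ℚ
ζ (suc (suc s)) = mkℝ (partialζ (suc (suc s))) (partialζ-cauchy s)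

record Partition : Set where
  field
    parts         : List ℕ
    nonincreasing : Linked ℕ._≥_ parts
    parts≢0       : All NonZero parts

open Partition public

ℓ : Partition → ℕ
ℓ p = length (parts p)

integer : Partition → ℕ
integer p = product (parts p)

integer≢0 : ∀ p → NonZero (integer p)
integer≢0 p = product≢0 (parts≢0 p)

PartitionOfLength : ℕ → Set
PartitionOfLength k = Σ[ p ∈ Partition ] ℓ p ≡ k

-- ζ𝒫[ s ]^ k ≡ x says that the series defining ζ_𝒫({s}^k) converges, with sum x.
ζ𝒫[_]^_≡_ : ℕ → ℕ → ℝ → Set
ζ𝒫[ s ]^ k ≡ x = HasSum {PartitionOfLength k} (λ (p , _) → (1/ integer p ^ℕ s) {{integer≢0 p}}) x

infix 8 2^_ [-1]^_

2^_ : ℤ → ℚ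
2^ (+ n)    = + (2 ℕ.^ n) / 1
2^ -[1+ n ] = 1/ 2 ^ℕ suc n

[-1]^_ : ℕ → ℚ
[-1]^ n = _^_ +-*-rawSemiring (- 1ℚ) n

-- Finite closed formulas: polynomials with rational coefficients in the values of
-- ζ at even arguments.
data Formula : Set where
  const   : ℚ → Formula
  ζ[2*_]  : ℕ → Formula
  _⊕_ _⊗_ : Formula → Formula → Formula

⟦_⟧ : Formula → ℝ
⟦ const q ⟧  = fromℚ q
⟦ ζ[2* n ] ⟧ = ζ (2 ℕ.* n)
⟦ e ⊕ f ⟧    = ⟦ e ⟧ +ᴿ ⟦ f ⟧
⟦ e ⊗ f ⟧    = ⟦ e ⟧ *ᴿ ⟦ f ⟧

{-# OPTIONS --safe #-}

-- ζ_𝒫({s}^k) is the complete homogeneous symmetric function h_k of the numbers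
-- 1/nˢ, n ≥ 1.  For s = 2 and n ≤ N, expanding ∏ 1/(1 − t/n²) into partial fractions
-- gives h_k = Σ_{n ≤ N} 2 (−1)ⁿ⁻¹ N!²/((N − n)! (N + n)!) n⁻²ᵏ.  As N → ∞ the factorial
-- quotient tends to 1, so that ζ_𝒫({2}^k) = 2 (1 − 2¹⁻²ᵏ) ζ(2k), without mention of π
-- or of the sine product.  The identity
-- h_k(x²) = Σ_{n ≤ 2k} (−1)ⁿ h_n(x) h_{2k−n}(x) then passes from {2^t} to {2^(t+1)}.
module Submission where

-- Beyond algebra at a finite cutoff N, two limit steps carry the proof. The first replaces the
-- factorial quotient by 1. Its defect 1 - N!²/((N - n)! (N + n)!) is at most n²/(N + 1), which
-- costs two powers of n: in degree k the total error is 2/(N + 1) times a partial sum of ζ(2k - 2),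
-- and this bound tends to 0 only for k ≥ 2. Degree 1 is the series ζ(2) itself. The second replaces
-- ⌊N/2⌋ by N once the alternating sum is written in terms of partial sums of ζ. Degree 0 fits the
-- same closed form because -2 ζ(0) = 1, which is how ζ(0) enters the formula. Since all terms are
-- nonnegative, convergence along the cutoffs gives unconditional convergence.

open import Defs

-- Rational arithmetic of reciprocal powers.

module Arithmetic where
  open import Data.Integer.Base as ℤ using (+_)
  import Data.Integer.Properties as ℤ
  open import Data.Nat.Base as ℕ using (ℕ; zero; suc)
  import Data.Nat.Properties as ℕ
  open import Data.Rational.Base hiding (1/_)
  open import Data.Rational.Properties
  open import Data.Rational.Solver using (module +-*-Solver)
  import Data.Rational.Unnormalised.Base as ℚᵘ
  import Data.Rational.Unnormalised.Properties as ℚᵘ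
  open import Relation.Binary.PropositionalEquality
  open +-*-Solver

  ι : ℕ → ℚ
  ι n = + n / 1

  ι-* : ∀ m n → ι (m ℕ.* n) ≡ ι m * ι n
  ι-* m n = toℚᵘ-injective (begin-equality
    toℚᵘ (ι (m ℕ.* n))                      ≃⟨ toℚᵘ-/ (+ (m ℕ.* n)) 0 ⟩
    ℚᵘ.mkℚᵘ (+ (m ℕ.* n)) 0                 ≃⟨ ℚᵘ.*≡* (cong (ℤ._* + 1) (ℤ.pos-* m n)) ⟩
    ℚᵘ.mkℚᵘ (+ m) 0 ℚᵘ.* ℚᵘ.mkℚᵘ (+ n) 0    ≃⟨ ℚᵘ.*-cong (toℚᵘ-/ (+ m) 0) (toℚᵘ-/ (+ n) 0) ⟨
    toℚᵘ (ι m) ℚᵘ.* toℚᵘ (ι n)              ≃⟨ toℚᵘ-homo-* (ι m) (ι n) ⟨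
    toℚᵘ (ι m * ι n)                        ∎)
    where open ℚᵘ.≤-Reasoning

  ι-+ : ∀ m n → ι (m ℕ.+ n) ≡ ι m + ι n
  ι-+ m n = toℚᵘ-injective (begin-equality
    toℚᵘ (ι (m ℕ.+ n))                      ≃⟨ toℚᵘ-/ (+ (m ℕ.+ n)) 0 ⟩
    ℚᵘ.mkℚᵘ (+ (m ℕ.+ n)) 0                 ≃⟨ ℚᵘ.*≡* (cong (ℤ._* + 1) (cong₂ ℤ._+_ (sym (ℤ.*-identityʳ (+ m))) (sym (ℤ.*-identityʳ (+ n))))) ⟩
    ℚᵘ.mkℚᵘ (+ m) 0 ℚᵘ.+ ℚᵘ.mkℚᵘ (+ n) 0    ≃⟨ ℚᵘ.+-cong (toℚᵘ-/ (+ m) 0) (toℚᵘ-/ (+ n) 0) ⟨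
    toℚᵘ (ι m) ℚᵘ.+ toℚᵘ (ι n)              ≃⟨ toℚᵘ-homo-+ (ι m) (ι n) ⟨
    toℚᵘ (ι m + ι n)                        ∎)
    where open ℚᵘ.≤-Reasoning

  ι-suc : ∀ n → ι (suc n) ≡ 1ℚ + ι n
  ι-suc = ι-+ 1

  ι*1/ : ∀ n .{{_ : ℕ.NonZero n}} → ι n * (+ 1 / n) ≡ 1ℚ
  ι*1/ (suc n) = toℚᵘ-injective (begin-equality
    toℚᵘ (ι (suc n) * (+ 1 / suc n))          ≃⟨ toℚᵘ-homo-* (ι (suc n)) (+ 1 / suc n) ⟩
    toℚᵘ (ι (suc n)) ℚᵘ.* toℚᵘ (+ 1 / suc n)  ≃⟨ ℚᵘ.*-cong (toℚᵘ-/ (+ suc n) 0) (toℚᵘ-/ (+ 1) n) ⟩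
    ℚᵘ.mkℚᵘ (+ suc n) 0 ℚᵘ.* ℚᵘ.mkℚᵘ (+ 1) n  ≃⟨ ℚᵘ.*-inverseʳ (ℚᵘ.mkℚᵘ (+ suc n) 0) ⟩
    toℚᵘ 1ℚ                                   ∎)
    where open ℚᵘ.≤-Reasoning

  ^-distribʳ-* : ∀ s m n → (m ℕ.* n) ℕ.^ s ≡ m ℕ.^ s ℕ.* n ℕ.^ s
  ^-distribʳ-* zero    m n = refl
  ^-distribʳ-* (suc s) m n = trans (cong (m ℕ.* n ℕ.*_) (^-distribʳ-* s m n))
    (ℕ.[m*n]*[o*p]≡[m*o]*[n*p] m n (m ℕ.^ s) (n ℕ.^ s))

  -- Reduces identities between reciprocals to identities between natural powers: both sides are
  -- inverses of the same integer.
  inverse-unique : ∀ a p q → a * p ≡ 1ℚ → a * q ≡ 1ℚ → p ≡ q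
  inverse-unique a p q ap≡1 aq≡1 = begin
    p              ≡⟨ *-identityʳ p ⟨
    p * 1ℚ         ≡⟨ cong (p *_) aq≡1 ⟨
    p * (a * q)    ≡⟨ solve 3 (λ a p q → p :* (a :* q) := (a :* p) :* q) refl a p q ⟩
    (a * p) * q    ≡⟨ cong (_* q) ap≡1 ⟩
    1ℚ * q         ≡⟨ *-identityˡ q ⟩
    q              ∎
    where open ≡-Reasoning

  1/^ℕ-inverse : ∀ n s .{{_ : ℕ.NonZero n}} → ι (n ℕ.^ s) * (1/ n ^ℕ s) ≡ 1ℚ
  1/^ℕ-inverse n s = ι*1/ (n ℕ.^ s) {{ℕ.m^n≢0 n s}}

  product-inverse : ∀ {a b p q} → a * p ≡ 1ℚ → b * q ≡ 1ℚ → (a * b) * (p * q) ≡ 1ℚ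
  product-inverse {a} {b} {p} {q} ap≡1 bq≡1 = trans
    (solve 4 (λ a b p q → (a :* b) :* (p :* q) := (a :* p) :* (b :* q)) refl a b p q)
    (cong₂ _*_ ap≡1 bq≡1)

  1/^ℕ-cong : ∀ {m n} s .{{_ : ℕ.NonZero m}} .{{_ : ℕ.NonZero n}} → m ≡ n → 1/ m ^ℕ s ≡ 1/ n ^ℕ s
  1/^ℕ-cong s refl = refl

  1/^ℕ-+ : ∀ n s t .{{_ : ℕ.NonZero n}} → 1/ n ^ℕ (s ℕ.+ t) ≡ (1/ n ^ℕ s) * (1/ n ^ℕ t)
  1/^ℕ-+ n s t = inverse-unique (ι (n ℕ.^ (s ℕ.+ t))) _ _ (1/^ℕ-inverse n (s ℕ.+ t))
    (trans (cong (_* ((1/ n ^ℕ s) * (1/ n ^ℕ t)))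
             (trans (cong ι (ℕ.^-distribˡ-+-* n s t)) (ι-* (n ℕ.^ s) (n ℕ.^ t))))
      (product-inverse {ι (n ℕ.^ s)} (1/^ℕ-inverse n s) (1/^ℕ-inverse n t)))

  1/^ℕ-* : ∀ m n s .{{_ : ℕ.NonZero m}} .{{_ : ℕ.NonZero n}} .{{_ : ℕ.NonZero (m ℕ.* n)}} →
           1/ (m ℕ.* n) ^ℕ s ≡ (1/ m ^ℕ s) * (1/ n ^ℕ s)
  1/^ℕ-* m n s = inverse-unique (ι ((m ℕ.* n) ℕ.^ s)) _ _ (1/^ℕ-inverse (m ℕ.* n) s)
    (trans (cong (_* ((1/ m ^ℕ s) * (1/ n ^ℕ s)))
             (trans (cong ι (^-distribʳ-* s m n)) (ι-* (m ℕ.^ s) (n ℕ.^ s))))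
      (product-inverse {ι (m ℕ.^ s)} (1/^ℕ-inverse m s) (1/^ℕ-inverse n s)))

  1/1^ℕ : ∀ s → 1/ 1 ^ℕ s ≡ 1ℚ
  1/1^ℕ s = inverse-unique (ι (1 ℕ.^ s)) _ _ (1/^ℕ-inverse 1 s) (trans (*-identityʳ _) (cong ι (ℕ.^-zeroˡ s)))

  *-nonNeg : ∀ {p q} → 0ℚ ≤ p → 0ℚ ≤ q → 0ℚ ≤ p * q
  *-nonNeg {p} {q} 0≤p 0≤q =
    nonNegative⁻¹ (p * q) {{nonNeg*nonNeg⇒nonNeg p {{nonNegative 0≤p}} q {{nonNegative 0≤q}}}}

  p≤p+q : ∀ p {q} → 0ℚ ≤ q → p ≤ p + q
  p≤p+q p {q} 0≤q = subst (_≤ p + q) (+-identityʳ p) (+-monoʳ-≤ p 0≤q)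

  p≤q+p : ∀ p {q} → 0ℚ ≤ q → p ≤ q + p
  p≤q+p p {q} 0≤q = subst (p ≤_) (+-comm p q) (p≤p+q p 0≤q)

  p-q+q-r : ∀ p q r → (p - q) + (q - r) ≡ p - r
  p-q+q-r = solve 3 (λ p q r → (p :- q) :+ (q :- r) := p :- r) refl

-- Complete homogeneous symmetric polynomials and convolutions.

module SymmetricPolynomials where
  open import Data.List.Base using (foldr; applyUpTo)
  open import Data.Nat.Base as ℕ using (ℕ; zero; suc; s≤s; z≤n; _∸_)
  import Data.Nat.Properties as ℕ
  open import Data.Rational.Base hiding (1/_)
  open import Data.Rational.Properties
  open import Data.Rational.Solver using (module +-*-Solver)
  open import Function.Base using (_∘_)
  open import Relation.Binary.PropositionalEquality
  open Arithmetic
  open +-*-Solver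
  open ≡-Reasoning

  -- h x k N is the complete homogeneous symmetric polynomial of degree k in x 0, …, x (N − 1).
  h : (ℕ → ℚ) → ℕ → ℕ → ℚ
  h x zero    N       = 1ℚ
  h x (suc k) zero    = 0ℚ
  h x (suc k) (suc N) = h x (suc k) N + x N * h x k (suc N)

  h-cong : ∀ {x y} → x ≗ y → ∀ k N → h x k N ≡ h y k N
  h-cong x≗y zero    N       = refl
  h-cong x≗y (suc k) zero    = refl
  h-cong x≗y (suc k) (suc N) =
    cong₂ _+_ (h-cong x≗y (suc k) N) (cong₂ _*_ (x≗y N) (h-cong x≗y k (suc N)))

  h-nonNeg : ∀ {x} → (∀ n → 0ℚ ≤ x n) → ∀ k N → 0ℚ ≤ h x k N
  h-nonNeg 0≤x zero    N       = nonNegative⁻¹ 1ℚ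
  h-nonNeg 0≤x (suc k) zero    = ≤-refl
  h-nonNeg 0≤x (suc k) (suc N) =
    ≤-trans (h-nonNeg 0≤x (suc k) N) (p≤p+q _ (*-nonNeg (0≤x N) (h-nonNeg 0≤x k (suc N))))

  convolution : (ℕ → ℚ) → (ℕ → ℚ) → ℕ → ℚ
  convolution a b zero    = a 0 * b 0
  convolution a b (suc m) = a 0 * b (suc m) + convolution (a ∘ suc) b m

  convolution-linearˡ : ∀ {a b c} y d → (∀ i → c i ≡ a i + y * b i) → ∀ m →
    convolution c d m ≡ convolution a d m + y * convolution b d m
  convolution-linearˡ {a} {b} y d c≗ zero = trans (cong (_* d 0) (c≗ 0))
    (solve 4 (λ a b y d → (a :+ y :* b) :* d := a :* d :+ y :* (b :* d)) refl (a 0) (b 0) y (d 0))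
  convolution-linearˡ {a} {b} {c} y d c≗ (suc m) = trans
    (cong₂ _+_ (cong (_* d (suc m)) (c≗ 0)) (convolution-linearˡ y d (c≗ ∘ suc) m))
    (solve 6 (λ a b y d p q → (a :+ y :* b) :* d :+ (p :+ y :* q) := (a :* d :+ p) :+ y :* (b :* d :+ q))
      refl (a 0) (b 0) y (d (suc m)) (convolution (a ∘ suc) d m) (convolution (b ∘ suc) d m))

  -- In terms of generating functions: A′ (1 − y t) = A implies A′ B (1 − y t) = A B.
  convolution-geometricˡ : ∀ a a′ y b → a′ 0 ≡ a 0 → (∀ i → a′ (suc i) ≡ a (suc i) + y * a′ i) → ∀ m →
    convolution a′ b (suc m) ≡ convolution a b (suc m) + y * convolution a′ b m
  convolution-geometricˡ a a′ y b a′0≡ a′≗ m = trans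
    (cong₂ _+_ (cong (_* b (suc m)) a′0≡) (convolution-linearˡ y b a′≗ m))
    (sym (+-assoc (a 0 * b (suc m)) (convolution (a ∘ suc) b m) (y * convolution a′ b m)))

  -- `convolution` unfolds on the left only, so this mirror image of `convolution-geometricˡ` needs
  -- an induction, whose base case already has two terms.
  convolution-geometricʳ : ∀ a b b′ y → b′ 0 ≡ b 0 → (∀ i → b′ (suc i) ≡ b (suc i) + y * b′ i) → ∀ m →
    convolution a b′ (suc m) ≡ convolution a b (suc m) + y * convolution a b′ m
  convolution-geometricʳ a b b′ y b′0≡ b′≗ zero = trans
    (cong₂ _+_ (cong (a 0 *_) (b′≗ 0)) (cong (a 1 *_) b′0≡))
    (solve 6 (λ a₀ a₁ b₀ b₁ y b₀′ → a₀ :* (b₁ :+ y :* b₀′) :+ a₁ :* b₀ := (a₀ :* b₁ :+ a₁ :* b₀) :+ y :* (a₀ :* b₀′))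
      refl (a 0) (a 1) (b 0) (b 1) y (b′ 0))
  convolution-geometricʳ a b b′ y b′0≡ b′≗ (suc m) = trans
    (cong₂ _+_ (cong (a 0 *_) (b′≗ (suc m))) (convolution-geometricʳ (a ∘ suc) b b′ y b′0≡ b′≗ m))
    (solve 6 (λ a b y b′ p q → a :* (b :+ y :* b′) :+ (p :+ y :* q) := (a :* b :+ p) :+ y :* (a :* b′ :+ q))
      refl (a 0) (b (suc (suc m))) y (b′ (suc m)) (convolution (a ∘ suc) b (suc m)) (convolution (a ∘ suc) b′ m))

  convolution-zeroʳ : ∀ a b → (∀ i → b (suc i) ≡ 0ℚ) → ∀ m → convolution a b m ≡ a m * b 0
  convolution-zeroʳ a b b≗0 zero    = refl
  convolution-zeroʳ a b b≗0 (suc m) = trans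
    (cong₂ _+_ (trans (cong (a 0 *_) (b≗0 m)) (*-zeroʳ (a 0))) (convolution-zeroʳ (a ∘ suc) b b≗0 m))
    (+-identityˡ _)

  convolution≡foldr : ∀ {a b m} f → (∀ i → i ℕ.≤ m → f i ≡ a i * b (m ∸ i)) →
    convolution a b m ≡ foldr _+_ 0ℚ (applyUpTo f (suc m))
  convolution≡foldr {m = zero}  f f≗ = trans (sym (f≗ 0 z≤n)) (sym (+-identityʳ (f 0)))
  convolution≡foldr {m = suc m} f f≗ = cong₂ _+_ (sym (f≗ 0 z≤n))
    (convolution≡foldr (f ∘ suc) (λ i i≤m → f≗ (suc i) (s≤s i≤m)))

  signed : (ℕ → ℚ) → ℕ → ℚ
  signed a i = [-1]^ i * a i

  -- Unlike `2 * k`, this exposes two constructors at each step, so that recurrences advancing by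
  -- two compute.
  double : ℕ → ℕ
  double zero    = zero
  double (suc k) = suc (suc (double k))

  double≡2* : ∀ k → double k ≡ 2 ℕ.* k
  double≡2* zero    = refl
  double≡2* (suc k) = cong suc (trans (cong suc (double≡2* k)) (sym (ℕ.+-suc k (k ℕ.+ 0))))

  -- ∏ 1/(1 − xₙ t) · ∏ 1/(1 + xₙ t) = ∏ 1/(1 − xₙ² t²)
  h-square : ∀ x k N → h (λ n → x n * x n) k N ≡
    convolution (signed (λ i → h x i N)) (λ i → h x i N) (double k)
  h-square x zero    N       = refl
  h-square x (suc k) zero    = sym (trans
    (convolution-zeroʳ (signed (λ i → h x i 0)) (λ i → h x i 0) (λ _ → refl) (suc (suc (double k))))
    (cong (_* 1ℚ) (*-zeroʳ ([-1]^ (suc (suc (double k)))))))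
  h-square x (suc k) (suc N) = begin
    h x² (suc k) N + y * y * h x² k (suc N)
      ≡⟨ cong₂ (λ p q → p + y * y * q) (h-square x (suc k) N) (h-square x k (suc N)) ⟩
    convolution s a (2 ℕ.+ m) + y * y * convolution s′ a′ m
      -- The inserted `convolution s′ a (suc m)` contains the new variable in the signed factor
      -- only; through it the factors 1/(1 + y t) and 1/(1 - y t) are adjoined one at a time.
      ≡⟨ solve 4 (λ p q r y → p :+ y :* y :* q := (p :+ :- y :* r) :+ y :* (r :+ y :* q)) refl
           (convolution s a (2 ℕ.+ m)) (convolution s′ a′ m) (convolution s′ a (suc m)) y ⟩
    (convolution s a (2 ℕ.+ m) + - y * convolution s′ a (suc m)) + y * (convolution s′ a (suc m) + y * convolution s′ a′ m)
      ≡⟨ cong₂ (λ p q → p + y * q) (convolution-geometricˡ s s′ (- y) a refl s-rec (suc m)) (convolution-geometricʳ s′ a a′ y refl a-rec m) ⟨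
    convolution s′ a (2 ℕ.+ m) + y * convolution s′ a′ (suc m)
      ≡⟨ convolution-geometricʳ s′ a a′ y refl a-rec (suc m) ⟨
    convolution s′ a′ (2 ℕ.+ m)
      ∎
    where
      x² = λ n → x n * x n
      y  = x N
      m  = double k
      a  = λ i → h x i N
      a′ = λ i → h x i (suc N)
      s  = signed a
      s′ = signed a′
      a-rec : ∀ i → a′ (suc i) ≡ a (suc i) + y * a′ i
      a-rec i = refl
      s-rec : ∀ i → s′ (suc i) ≡ s (suc i) + - y * s′ i
      s-rec i = solve 4 (λ e p y q → (con (- 1ℚ) :* e) :* (p :+ y :* q) := (con (- 1ℚ) :* e) :* p :+ :- y :* (e :* q))
        refl ([-1]^ i) (a (suc i)) y (a′ i)

-- Limits of rational sequences.

module Asymptotics where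
  open import Data.Integer.Base using (+_)
  open import Data.Nat.Base as ℕ using (ℕ; zero; suc; ⌊_/2⌋)
  import Data.Nat.Properties as ℕ
  open import Data.Product.Base using (∃-syntax; _×_; _,_)
  open import Data.Rational.Base hiding (1/_)
  open import Data.Rational.Properties
  open import Function.Base using (_∘_)
  open import Relation.Binary.PropositionalEquality
  open Arithmetic
  open SymmetricPolynomials

  infix 4 _∼_

  -- u tends to the real number x exactly when u ∼ seq x.
  record _∼_ (u v : ℕ → ℚ) : Set where
    constructor asymptotic
    field
      eventually : ∀ ε → 0ℚ < ε → ∃[ N ] ∀ n → N ℕ.≤ n → ∣ u n - v n ∣ < ε

  open _∼_ public

  ∼-resp-≗ : ∀ {u u′ v v′} → u ≗ u′ → v ≗ v′ → u ∼ v → u′ ∼ v′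
  ∼-resp-≗ u≗u′ v≗v′ u∼v .eventually ε 0<ε with eventually u∼v ε 0<ε
  ... | N , close = N , λ n N≤n →
    subst₂ (λ p q → ∣ p - q ∣ < ε) (u≗u′ n) (v≗v′ n) (close n N≤n)

  ∼-refl : ∀ u → u ∼ u
  ∼-refl u .eventually ε 0<ε = 0 , λ n _ → subst (_< ε) (sym (cong ∣_∣ (+-inverseʳ (u n)))) 0<ε

  ∼-trans : ∀ {u v w} → u ∼ v → v ∼ w → u ∼ w
  ∼-trans {u} {v} {w} u∼v v∼w .eventually ε 0<ε =
    let (M , p) = eventually u∼v (½ * ε) (half-pos 0<ε)
        (N , q) = eventually v∼w (½ * ε) (half-pos 0<ε)
    in M ℕ.⊔ N , λ n M⊔N≤n →
       subst (λ d → ∣ d ∣ < ε) (p-q+q-r (u n) (v n) (w n))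
         (∣+∣<ε (u n - v n) (v n - w n)
           (p n (ℕ.m⊔n≤o⇒m≤o M N M⊔N≤n)) (q n (ℕ.m⊔n≤o⇒n≤o M N M⊔N≤n)))

  ∼-+ : ∀ {u v w z} → u ∼ w → v ∼ z → (λ n → u n + v n) ∼ (λ n → w n + z n)
  ∼-+ {u} {v} {w} {z} u∼w v∼z .eventually ε 0<ε =
    let (M , p) = eventually u∼w (½ * ε) (half-pos 0<ε)
        (N , q) = eventually v∼z (½ * ε) (half-pos 0<ε)
    in M ℕ.⊔ N , λ n M⊔N≤n →
       subst (λ d → ∣ d ∣ < ε) (sym (add-lemma (u n) (v n) (w n) (z n)))
         (∣+∣<ε (u n - w n) (v n - z n)
           (p n (ℕ.m⊔n≤o⇒m≤o M N M⊔N≤n)) (q n (ℕ.m⊔n≤o⇒n≤o M N M⊔N≤n)))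

  ∼-bounded : ∀ {u} x → u ∼ seq x → ∃[ B ] Positive B × (∃[ N ] ∀ n → N ℕ.≤ n → ∣ u n ∣ ≤ B)
  ∼-bounded {u} x u∼x =
    let (B , B>0 , K , x≤B) = bounded x
        (N , close)         = eventually u∼x 1ℚ (positive⁻¹ 1ℚ)
    in 1ℚ + B , pos+pos⇒pos 1ℚ B {{B>0}} , K ℕ.⊔ N , λ n K⊔N≤n →
       subst (λ z → ∣ z ∣ ≤ 1ℚ + B) (sym (sub-add (u n) (seq x n)))
         (≤-trans (∣p+q∣≤∣p∣+∣q∣ (u n - seq x n) (seq x n))
           (+-mono-≤ (<⇒≤ (close n (ℕ.m⊔n≤o⇒n≤o K N K⊔N≤n))) (x≤B n (ℕ.m⊔n≤o⇒m≤o K N K⊔N≤n))))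

  ∼-* : ∀ {u v} x y → u ∼ seq x → v ∼ seq y → (λ n → u n * v n) ∼ seq (x *ᴿ y)
  ∼-* {u} {v} x y u∼x v∼y .eventually ε 0<ε =
    let (B , B>0 , K , u≤B) = ∼-bounded x u∼x
        (C , C>0 , L , y≤C) = bounded y
        (δ , 0<δ , f)       = scaled B (½ * ε) B>0 (half-pos 0<ε)
        (η , 0<η , g)       = scaled C (½ * ε) C>0 (half-pos 0<ε)
        (M , p)             = eventually v∼y δ 0<δ
        (N , q)             = eventually u∼x η 0<η
        KL≤ = λ {i} (R≤i : (K ℕ.⊔ L) ℕ.⊔ (M ℕ.⊔ N) ℕ.≤ i) → ℕ.m⊔n≤o⇒m≤o (K ℕ.⊔ L) (M ℕ.⊔ N) R≤i
        MN≤ = λ {i} (R≤i : (K ℕ.⊔ L) ℕ.⊔ (M ℕ.⊔ N) ℕ.≤ i) → ℕ.m⊔n≤o⇒n≤o (K ℕ.⊔ L) (M ℕ.⊔ N) R≤i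
    in (K ℕ.⊔ L) ℕ.⊔ (M ℕ.⊔ N) , λ n R≤n →
       subst (λ z → ∣ z ∣ < ε) (sym (mul-lemma (u n) (v n) (seq x n) (seq y n)))
         (∣+∣<ε (u n * (v n - seq y n)) (seq y n * (u n - seq x n))
           (f (u n) (v n - seq y n) (u≤B n (ℕ.m⊔n≤o⇒m≤o K L (KL≤ R≤n))) (p n (ℕ.m⊔n≤o⇒m≤o M N (MN≤ R≤n))))
           (g (seq y n) (u n - seq x n) (y≤C n (ℕ.m⊔n≤o⇒n≤o K L (KL≤ R≤n))) (q n (ℕ.m⊔n≤o⇒n≤o M N (MN≤ R≤n)))))

  -- Needed for the even terms of the alternating series, whose partial sums run to half the index.
  -- The doubled threshold keeps ⌊n/2⌋ above the Cauchy threshold.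
  ∼-halve : ∀ x → (λ n → seq x ⌊ n /2⌋) ∼ seq x
  ∼-halve x .eventually ε 0<ε with isCauchy x ε 0<ε
  ... | N , close = N ℕ.+ N , λ n 2N≤n → close ⌊ n /2⌋ n
    (subst (ℕ._≤ ⌊ n /2⌋) (sym (ℕ.n≡⌊n+n/2⌋ N)) (ℕ.⌊n/2⌋-mono 2N≤n))
    (ℕ.≤-trans (ℕ.m≤m+n N N) 2N≤n)

  -- The null sequence is kept as a separate `z` because `∼-*` delivers the limit 0 as an
  -- unsimplified product.
  ∼-squeeze : ∀ {u v w z} → (∀ n → ∣ u n - v n ∣ ≤ w n) → w ∼ z → z ≗ (λ _ → 0ℚ) → u ∼ v
  ∼-squeeze {u} {v} {w} {z} u-v≤w w∼z z≗0 .eventually ε 0<ε with eventually w∼z ε 0<ε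
  ... | N , close = N , λ n N≤n → begin-strict
    ∣ u n - v n ∣    ≤⟨ u-v≤w n ⟩
    w n              ≡⟨ 0≤p⇒∣p∣≡p (≤-trans (0≤∣p∣ (u n - v n)) (u-v≤w n)) ⟨
    ∣ w n ∣          ≡⟨ cong ∣_∣ (trans (cong (λ p → w n - p) (z≗0 n)) (+-identityʳ (w n))) ⟨
    ∣ w n - z n ∣    <⟨ close n N≤n ⟩
    ε                ∎
    where open ≤-Reasoning

  1/n∼0 : (λ n → + 1 / suc n) ∼ (λ _ → 0ℚ)
  1/n∼0 .eventually ε 0<ε with archimedean ε 0<ε
  ... | N , 1/N<ε = N , λ n N≤n → begin-strict
    ∣ + 1 / suc n - 0ℚ ∣    ≡⟨ cong ∣_∣ (+-identityʳ (+ 1 / suc n)) ⟩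
    ∣ + 1 / suc n ∣         ≡⟨ 0≤p⇒∣p∣≡p (nonNegative⁻¹ _ {{normalize-nonNeg 1 (suc n)}}) ⟩
    + 1 / suc n             ≤⟨ 1/-antimono N≤n ⟩
    + 1 / suc N             <⟨ 1/N<ε ⟩
    ε                       ∎
    where open ≤-Reasoning

  convolutionᶠ : (ℕ → Formula) → (ℕ → Formula) → ℕ → Formula
  convolutionᶠ a b zero    = a 0 ⊗ b 0
  convolutionᶠ a b (suc m) = (a 0 ⊗ b (suc m)) ⊕ convolutionᶠ (a ∘ suc) b m

  seq-convolutionᶠ : ∀ a b m n →
    seq ⟦ convolutionᶠ a b m ⟧ n ≡ convolution (λ i → seq ⟦ a i ⟧ n) (λ i → seq ⟦ b i ⟧ n) m
  seq-convolutionᶠ a b zero    n = refl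
  seq-convolutionᶠ a b (suc m) n =
    cong (λ z → seq ⟦ a 0 ⟧ n * seq ⟦ b (suc m) ⟧ n + z) (seq-convolutionᶠ (a ∘ suc) b m n)

  ∼-convolution : ∀ {u v : ℕ → ℕ → ℚ} a b → (∀ i → u i ∼ seq ⟦ a i ⟧) → (∀ i → v i ∼ seq ⟦ b i ⟧) → ∀ m →
    (λ n → convolution (λ i → u i n) (λ i → v i n) m) ∼ seq ⟦ convolutionᶠ a b m ⟧
  ∼-convolution a b u∼ v∼ zero    = ∼-* ⟦ a 0 ⟧ ⟦ b 0 ⟧ (u∼ 0) (v∼ 0)
  ∼-convolution a b u∼ v∼ (suc m) =
    ∼-+ (∼-* ⟦ a 0 ⟧ ⟦ b (suc m) ⟧ (u∼ 0) (v∼ (suc m))) (∼-convolution (a ∘ suc) b (u∼ ∘ suc) v∼ m)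

-- From symmetric polynomials to unconditional sums over partitions.

module SumsOverPartitions where
  open import Data.Empty using (⊥-elim)
  open import Data.List.Base using (List; []; _∷_; _++_; map; foldr; length)
  open import Data.List.Membership.Propositional using (_∈_)
  open import Data.List.Membership.Propositional.Properties using (∈-map⁻; ∈-map⁺; ∈-++⁻; ∈-++⁺ˡ; ∈-++⁺ʳ; ∈-∃++)
  open import Data.List.Relation.Binary.Subset.Propositional using (_⊆_)
  import Data.List.Relation.Binary.Subset.Propositional.Properties as Subset
  open import Data.List.Relation.Unary.All as All using (All; []; _∷_)
  open import Data.List.Relation.Unary.AllPairs using ([]; _∷_)
  open import Data.List.Relation.Unary.Any using (here; there)
  open import Data.List.Relation.Unary.Linked as Linked using (Linked; []; [-]; _∷_)
  open import Data.List.Relation.Unary.Unique.Propositional using (Unique)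
  import Data.List.Relation.Unary.Unique.Propositional.Properties as Unique
  open import Data.Nat.Base as ℕ using (ℕ; zero; suc; pred; NonZero)
  open import Data.Nat.ListAction using (product)
  open import Data.Nat.ListAction.Properties using (product≢0; ∈⇒≤product)
  import Data.Nat.Properties as ℕ
  open import Data.Product.Base using (Σ-syntax; _×_; proj₁; proj₂; _,_)
  open import Data.Rational.Base hiding (1/_; NonZero)
  open import Data.Rational.Properties
  open import Data.Rational.Solver using (module +-*-Solver)
  open import Data.Sum.Base using (inj₁; inj₂)
  open import Function.Base using (_∘_)
  open import Relation.Binary.PropositionalEquality
  open Arithmetic
  open SymmetricPolynomials
  open Asymptotics

  total : {A : Set} → (A → ℚ) → List A → ℚ
  total f xs = foldr _+_ 0ℚ (map f xs)

  total-++ : ∀ {A : Set} (f : A → ℚ) xs ys → total f (xs ++ ys) ≡ total f xs + total f ys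
  total-++ f []       ys = sym (+-identityˡ (total f ys))
  total-++ f (x ∷ xs) ys = trans (cong (f x +_) (total-++ f xs ys)) (sym (+-assoc (f x) (total f xs) (total f ys)))

  -- Since `x` does not recur in `xs`, deleting one occurrence of `x` from `ys` leaves a list that
  -- still contains `xs`.
  total-mono-⊆ : ∀ {A : Set} {f : A → ℚ} {xs ys} → (∀ x → 0ℚ ≤ f x) → Unique xs → xs ⊆ ys → total f xs ≤ total f ys
  total-mono-⊆ {xs = []} {[]}     0≤f _ _ = ≤-refl
  total-mono-⊆ {xs = []} {y ∷ ys} 0≤f _ _ =
    ≤-trans (total-mono-⊆ {xs = []} {ys} 0≤f [] λ ()) (p≤q+p _ (0≤f y))
  total-mono-⊆ {f = f} {x ∷ xs} 0≤f (x∉xs ∷ unique) xs⊆ys with ∈-∃++ (xs⊆ys (here refl))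
  ... | ys₁ , ys₂ , refl = begin
    f x + total f xs                       ≤⟨ +-monoʳ-≤ (f x) (total-mono-⊆ 0≤f unique xs⊆ys₁ys₂) ⟩
    f x + total f (ys₁ ++ ys₂)             ≡⟨ cong (f x +_) (total-++ f ys₁ ys₂) ⟩
    f x + (total f ys₁ + total f ys₂)      ≡⟨ solve 3 (λ p q r → p :+ (q :+ r) := q :+ (p :+ r)) refl (f x) (total f ys₁) (total f ys₂) ⟩
    total f ys₁ + (f x + total f ys₂)      ≡⟨ total-++ f ys₁ (x ∷ ys₂) ⟨
    total f (ys₁ ++ x ∷ ys₂)               ∎
    where
      open ≤-Reasoning
      open +-*-Solver
      xs⊆ys₁ys₂ : xs ⊆ ys₁ ++ ys₂
      xs⊆ys₁ys₂ z∈xs with ∈-++⁻ ys₁ (xs⊆ys (there z∈xs))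
      ... | inj₁ z∈ys₁         = ∈-++⁺ˡ z∈ys₁
      ... | inj₂ (there z∈ys₂) = ∈-++⁺ʳ ys₁ z∈ys₂
      ... | inj₂ (here refl)   = ⊥-elim (All.lookup x∉xs z∈xs refl)

  -- Either all parts are at most N or the largest part is N + 1: the same case split as in the
  -- recurrence of `h`.
  partitions : ℕ → ℕ → List (List ℕ)
  partitions zero    N       = [] ∷ []
  partitions (suc k) zero    = []
  partitions (suc k) (suc N) = partitions (suc k) N ++ map (suc N ∷_) (partitions k (suc N))

  -- The variables of `h` are numbered from 0 and parts from 1, whence `pred`.
  weight : (ℕ → ℚ) → List ℕ → ℚ
  weight x []      = 1ℚ
  weight x (m ∷ l) = x (pred m) * weight x l

  weight-nonNeg : ∀ {x} → (∀ n → 0ℚ ≤ x n) → ∀ l → 0ℚ ≤ weight x l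
  weight-nonNeg 0≤x []      = nonNegative⁻¹ 1ℚ
  weight-nonNeg 0≤x (m ∷ l) = *-nonNeg (0≤x (pred m)) (weight-nonNeg 0≤x l)

  total-weight-∷ : ∀ x m ls → total (weight x) (map (m ∷_) ls) ≡ x (pred m) * total (weight x) ls
  total-weight-∷ x m []       = sym (*-zeroʳ (x (pred m)))
  total-weight-∷ x m (l ∷ ls) = trans (cong (weight x (m ∷ l) +_) (total-weight-∷ x m ls))
    (sym (*-distribˡ-+ (x (pred m)) (weight x l) (total (weight x) ls)))

  total-weight-partitions : ∀ x k N → total (weight x) (partitions k N) ≡ h x k N
  total-weight-partitions x zero    N       = +-identityʳ 1ℚ
  total-weight-partitions x (suc k) zero    = refl
  total-weight-partitions x (suc k) (suc N) = trans (total-++ (weight x) (partitions (suc k) N) _)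
    (cong₂ _+_ (total-weight-partitions x (suc k) N)
      (trans (total-weight-∷ x (suc N) (partitions k (suc N)))
        (cong (x N *_) (total-weight-partitions x k (suc N)))))

  IsPartition : ℕ → List ℕ → Set
  IsPartition k l = Linked ℕ._≥_ l × All NonZero l × length l ≡ k

  linked-∷ : ∀ {m l} → All (ℕ._≤ m) l → Linked ℕ._≥_ l → Linked ℕ._≥_ (m ∷ l)
  linked-∷ []        []     = [-]
  linked-∷ (n≤m ∷ _) [-]    = n≤m ∷ [-]
  linked-∷ (n≤m ∷ _) (r ∷ rs) = n≤m ∷ r ∷ rs

  head-bounds : ∀ {m l N} → Linked ℕ._≥_ (m ∷ l) → m ℕ.≤ N → All (ℕ._≤ N) (m ∷ l)
  head-bounds [-]      m≤N = m≤N ∷ []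
  head-bounds (r ∷ rs) m≤N = m≤N ∷ head-bounds rs (ℕ.≤-trans r m≤N)

  ∈-partitions⁻ : ∀ k N {l} → l ∈ partitions k N → IsPartition k l × All (ℕ._≤ N) l
  ∈-partitions⁻ zero    N       (here refl) = ([] , [] , refl) , []
  ∈-partitions⁻ (suc k) (suc N) l∈ with ∈-++⁻ (partitions (suc k) N) l∈
  ... | inj₁ l∈ˡ = let (isP , l≤N) = ∈-partitions⁻ (suc k) N l∈ˡ in isP , All.map ℕ.m≤n⇒m≤1+n l≤N
  ... | inj₂ l∈ʳ with ∈-map⁻ (suc N ∷_) l∈ʳ
  ...   | l′ , l′∈ , refl =
    let ((linked , l′≢0 , len) , l′≤) = ∈-partitions⁻ k (suc N) l′∈
    in (linked-∷ l′≤ linked , _ ∷ l′≢0 , cong suc len) , ℕ.≤-refl ∷ l′≤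

  ∈-partitions⁺ : ∀ k N {l} → IsPartition k l → All (ℕ._≤ N) l → l ∈ partitions k N
  ∈-partitions⁺ zero    N       {[]}    _ _ = here refl
  ∈-partitions⁺ (suc k) zero    {zero ∷ l} (_ , () ∷ _ , _) _
  ∈-partitions⁺ (suc k) zero    {suc _ ∷ l} _ (() ∷ _)
  ∈-partitions⁺ (suc k) (suc N) {m ∷ l} (linked , m≢0 ∷ l≢0 , len) (m≤ ∷ l≤) with ℕ.m≤n⇒m<n∨m≡n m≤
  ... | inj₁ m<1+N = ∈-++⁺ˡ
    (∈-partitions⁺ (suc k) N (linked , m≢0 ∷ l≢0 , len) (head-bounds linked (ℕ.≤-pred m<1+N)))
  ... | inj₂ refl  = ∈-++⁺ʳ (partitions (suc k) N) (∈-map⁺ (suc N ∷_)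
    (∈-partitions⁺ k (suc N) (Linked.tail linked , l≢0 , ℕ.suc-injective len) l≤))

  partitions-unique : ∀ k N → Unique (partitions k N)
  partitions-unique zero    N       = [] ∷ []
  partitions-unique (suc k) zero    = []
  partitions-unique (suc k) (suc N) = Unique.++⁺ (partitions-unique (suc k) N)
    (Unique.map⁺ (λ { refl → refl }) (partitions-unique k (suc N))) disjoint
    where
      disjoint : ∀ {l} → l ∈ partitions (suc k) N × l ∈ map (suc N ∷_) (partitions k (suc N)) → _
      disjoint (l∈ˡ , l∈ʳ) with ∈-map⁻ (suc N ∷_) l∈ʳ
      -- A common list would begin with N + 1, although every part of a list on the left is at most
      -- N.
      ... | _ , _ , refl = ℕ.1+n≰n (All.head (proj₂ (∈-partitions⁻ (suc k) N l∈ˡ)))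

  partsOf : ∀ {k} → PartitionOfLength k → List ℕ
  partsOf (p , _) = parts p

  isPartition : ∀ {k} (p : PartitionOfLength k) → IsPartition k (partsOf p)
  isPartition (p , ℓp≡k) = nonincreasing p , parts≢0 p , ℓp≡k

  NonZero-irrelevant : ∀ {n} (p q : NonZero n) → p ≡ q
  NonZero-irrelevant {suc n} _ _ = refl

  -- The other components are proofs of propositions with unique proofs. Injectivity lets
  -- duplicate-freeness pass from partitions to their lists of parts.
  partsOf-injective : ∀ {k} {p q : PartitionOfLength k} → partsOf p ≡ partsOf q → p ≡ q
  partsOf-injective {p = record { parts = l ; nonincreasing = r ; parts≢0 = z } , e}
                    {record { nonincreasing = r′ ; parts≢0 = z′ } , e′} refl
    with refl ← Linked.irrelevant ℕ.≤-irrelevant r r′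
       | refl ← All.irrelevant NonZero-irrelevant z z′
       | refl ← ℕ.≡-irrelevant e e′ = refl

  fromParts : ∀ {k} ls → All (IsPartition k) ls → Σ[ S ∈ List (PartitionOfLength k) ] map partsOf S ≡ ls
  fromParts []       []                               = [] , refl
  fromParts (l ∷ ls) ((linked , l≢0 , len) ∷ isPs) with fromParts ls isPs
  ... | S , refl = (record { parts = l ; nonincreasing = linked ; parts≢0 = l≢0 } , len) ∷ S , refl

  -- A product of nonzero parts is at least each of its factors, so the integer of a partition
  -- bounds all its parts.
  partsBound : ∀ {k} → List (PartitionOfLength k) → ℕ
  partsBound []            = 0
  partsBound ((p , _) ∷ T) = integer p ℕ.⊔ partsBound T

  parts≤partsBound : ∀ {k} {p : PartitionOfLength k} {T} → p ∈ T → All (ℕ._≤ partsBound T) (partsOf p)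
  parts≤partsBound {p = p , _} {_ ∷ T} (here refl) =
    All.tabulate (λ m∈p → ℕ.≤-trans (∈⇒≤product (parts≢0 p) m∈p) (ℕ.m≤m⊔n (integer p) (partsBound T)))
  parts≤partsBound {T = (q , _) ∷ T} (there p∈T) =
    All.map (λ m≤ → ℕ.≤-trans m≤ (ℕ.m≤n⊔m (integer q) (partsBound T))) (parts≤partsBound p∈T)

  1/product^ℕ : ∀ s {l} (l≢0 : All NonZero l) →
    (1/ product l ^ℕ s) {{product≢0 l≢0}} ≡ weight (λ n → 1/ suc n ^ℕ s) l
  1/product^ℕ s []                    = 1/1^ℕ s
  1/product^ℕ s {suc m ∷ l} (_ ∷ l≢0) = trans
    (1/^ℕ-* (suc m) (product l) s {{_}} {{product≢0 l≢0}} {{product≢0 {suc m ∷ l} (_ ∷ l≢0)}})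
    (cong ((1/ suc m ^ℕ s) *_) (1/product^ℕ s l≢0))

  p≤∣p∣ : ∀ p → p ≤ ∣ p ∣
  p≤∣p∣ p with ≤-total 0ℚ p
  ... | inj₁ 0≤p = ≤-reflexive (sym (0≤p⇒∣p∣≡p 0≤p))
  ... | inj₂ p≤0 = ≤-trans p≤0 (0≤∣p∣ p)

  sandwich : ∀ {a b t z ε} → a ≤ t → t ≤ b → ∣ a - z ∣ ≤ ε → ∣ b - z ∣ ≤ ε → ∣ t - z ∣ ≤ ε
  sandwich {a} {b} {t} {z} a≤t t≤b a≈z b≈z with ∣p∣≡p∨∣p∣≡-p (t - z)
  ... | inj₁ eq = subst (_≤ _) (sym eq) (≤-trans (+-monoˡ-≤ (- z) t≤b) (≤-trans (p≤∣p∣ (b - z)) b≈z))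
  ... | inj₂ eq = subst (_≤ _) (sym eq) (≤-trans (neg-antimono-≤ (+-monoˡ-≤ (- z) a≤t))
    (≤-trans (p≤∣p∣ (- (a - z))) (subst (_≤ _) (sym (∣-p∣≡∣p∣ (a - z))) a≈z)))

  -- Once a finite set of partitions contains all those with parts ≤ N, its sum
  -- lies between two values of h at arguments ≥ N.
  h∼⇒ζ𝒫 : ∀ s k x → h (λ n → 1/ suc n ^ℕ s) k ∼ seq x → ζ𝒫[ s ]^ k ≡ x
  h∼⇒ζ𝒫 s k x h∼x ε 0<ε with eventually h∼x (½ * ε) (half-pos 0<ε) | isCauchy x (½ * ε) (half-pos 0<ε)
  ... | N₁ , h-close | N₂ , x-close = S , λ T unique S⊆T → N , λ n N≤n →
    subst (λ z → ∣ z - seq x n ∣ ≤ ε) (total-partsOf T)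
      (sandwich (lower T S⊆T) (upper T unique)
        (close N n ℕ.≤-refl N≤n)
        (close (N ℕ.⊔ partsBound T) n (ℕ.m≤m⊔n N (partsBound T)) N≤n))
    where
      y = λ n → 1/ suc n ^ℕ s
      N = N₁ ℕ.⊔ N₂
      listing = fromParts (partitions k N) (All.tabulate (proj₁ ∘ ∈-partitions⁻ k N))
      S = proj₁ listing

      0≤weight : ∀ l → 0ℚ ≤ weight y l
      0≤weight = weight-nonNeg (λ n → 1/n^s-nonNeg n s)

      close : ∀ m n → N ℕ.≤ m → N ℕ.≤ n → ∣ h y k m - seq x n ∣ ≤ ε
      close m n N≤m N≤n = subst (λ z → ∣ z ∣ ≤ ε) (p-q+q-r (h y k m) (seq x m) (seq x n))
        (<⇒≤ (∣+∣<ε (h y k m - seq x m) (seq x m - seq x n)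
          (h-close m (ℕ.m⊔n≤o⇒m≤o N₁ N₂ N≤m))
          (x-close m n (ℕ.m⊔n≤o⇒n≤o N₁ N₂ N≤m) (ℕ.m⊔n≤o⇒n≤o N₁ N₂ N≤n))))

      total-partsOf : ∀ T → total (weight y) (map partsOf T) ≡
        foldr _+_ 0ℚ (map (λ (p , _) → (1/ integer p ^ℕ s) {{integer≢0 p}}) T)
      total-partsOf []            = refl
      total-partsOf ((p , _) ∷ T) = cong₂ _+_ (sym (1/product^ℕ s (parts≢0 p))) (total-partsOf T)

      lower : ∀ T → S ⊆ T → h y k N ≤ total (weight y) (map partsOf T)
      lower T S⊆T = subst (_≤ total (weight y) (map partsOf T)) (total-weight-partitions y k N)
        (total-mono-⊆ 0≤weight (partitions-unique k N)
          (subst (_⊆ map partsOf T) (proj₂ listing) (Subset.map⁺ partsOf S⊆T)))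

      upper : ∀ T → Unique T → total (weight y) (map partsOf T) ≤ h y k (N ℕ.⊔ partsBound T)
      upper T unique = subst (total (weight y) (map partsOf T) ≤_) (total-weight-partitions y k M)
        (total-mono-⊆ 0≤weight (Unique.map⁺ partsOf-injective unique) T⊆)
        where
          -- The join with `N` keeps the index in the range where `close` applies.
          M = N ℕ.⊔ partsBound T
          T⊆ : map partsOf T ⊆ partitions k M
          T⊆ l∈ with ∈-map⁻ partsOf l∈
          ... | p , p∈T , refl = ∈-partitions⁺ k M (isPartition p)
            (All.map (λ m≤ → ℕ.≤-trans m≤ (ℕ.m≤n⊔m N (partsBound T))) (parts≤partsBound p∈T))

-- Partial fractions of the finite products ∏ 1/(1 - t/n²).

module PartialFractions where
  import Data.Integer.Base as ℤ
  open import Data.Nat.Base as ℕ using (ℕ; zero; suc)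
  import Data.Nat.Properties as ℕ
  open import Data.Rational.Base hiding (1/_)
  open import Data.Rational.Properties
  open import Data.Rational.Solver using (module +-*-Solver)
  open import Relation.Binary.PropositionalEquality
  open Arithmetic
  open SymmetricPolynomials
  open +-*-Solver using (solve; con; _:+_; _:*_; _:-_; :-_; _:=_)

  Σ< : (ℕ → ℚ) → ℕ → ℚ
  Σ< f zero    = 0ℚ
  Σ< f (suc N) = Σ< f N + f N

  Σ<-cong : ∀ {f g} → f ≗ g → Σ< f ≗ Σ< g
  Σ<-cong f≗g zero    = refl
  Σ<-cong f≗g (suc N) = cong₂ _+_ (Σ<-cong f≗g N) (f≗g N)

  Σ<-+* : ∀ f y g N → Σ< (λ n → f n + y * g n) N ≡ Σ< f N + y * Σ< g N
  Σ<-+* f y g zero    = solve 1 (λ y → con 0ℚ := con 0ℚ :+ y :* con 0ℚ) refl y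
  Σ<-+* f y g (suc N) = trans (cong (_+ (f N + y * g N)) (Σ<-+* f y g N))
    (solve 5 (λ p q a b y → (p :+ y :* q) :+ (a :+ y :* b) := (p :+ a) :+ y :* (q :+ b)) refl (Σ< f N) (Σ< g N) (f N) (g N) y)

  Σ<-* : ∀ y g N → Σ< (λ n → y * g n) N ≡ y * Σ< g N
  Σ<-* y g zero    = sym (*-zeroʳ y)
  Σ<-* y g (suc N) = trans (cong (_+ y * g N) (Σ<-* y g N)) (sym (*-distribˡ-+ y (Σ< g N) (g N)))

  Σ<-close : ∀ {f g b} N → (∀ n → n ℕ.< N → ∣ f n - g n ∣ ≤ b n) → ∣ Σ< f N - Σ< g N ∣ ≤ Σ< b N
  Σ<-close zero    close = ≤-refl
  Σ<-close {f} {g} {b} (suc N) close = begin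
    ∣ (Σ< f N + f N) - (Σ< g N + g N) ∣      ≡⟨ cong ∣_∣ (add-lemma (Σ< f N) (f N) (Σ< g N) (g N)) ⟩
    ∣ (Σ< f N - Σ< g N) + (f N - g N) ∣      ≤⟨ ∣p+q∣≤∣p∣+∣q∣ (Σ< f N - Σ< g N) (f N - g N) ⟩
    ∣ Σ< f N - Σ< g N ∣ + ∣ f N - g N ∣      ≤⟨ +-mono-≤ (Σ<-close N (λ n n<N → close n (ℕ.m≤n⇒m≤1+n n<N))) (close N ℕ.≤-refl) ⟩
    Σ< b N + b N                             ∎
    where open ≤-Reasoning

  partialζ≡Σ< : ∀ s N → partialζ s N ≡ Σ< (λ n → 1/ suc n ^ℕ s) N
  partialζ≡Σ< s zero    = refl
  partialζ≡Σ< s (suc N) = cong (_+ 1/ suc N ^ℕ s) (partialζ≡Σ< s N)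

  r : ℕ → ℚ
  r n = ℤ.+ 1 / suc n

  r-nonNeg : ∀ n → 0ℚ ≤ r n
  r-nonNeg n = nonNegative⁻¹ _ {{normalize-nonNeg 1 (suc n)}}

  -- The inverted integer is spelled as a polynomial in `ι m` and `ι n`, so that the ring solver can
  -- bring it next to `r`.
  r[m+n]-inverse : ∀ m n → (1ℚ + (ι m + ι n)) * r (m ℕ.+ n) ≡ 1ℚ
  r[m+n]-inverse m n = trans
    (cong (_* r (m ℕ.+ n)) (sym (trans (ι-suc (m ℕ.+ n)) (cong (1ℚ +_) (ι-+ m n)))))
    (ι*1/ (suc (m ℕ.+ n)))

  y : ℕ → ℚ
  y n = 1/ suc n ^ℕ 2

  y-inverse : ∀ n → (1ℚ + ι n) * (1ℚ + ι n) * y n ≡ 1ℚ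
  y-inverse n = trans
    (cong (_* y n) (sym (trans (cong (λ m → ι (suc n ℕ.* m)) (ℕ.*-identityʳ (suc n)))
      (trans (ι-* (suc n) (suc n)) (cong₂ _*_ (ι-suc n) (ι-suc n))))))
    (1/^ℕ-inverse (suc n) 2)

  -- W N n = N!² / ((N − n)! (N + n)!) = ∏_{j ≤ n} (N − j + 1)/(N + j).  The subtraction
  -- is rational, which makes W vanish for n > N and its recurrences free of side conditions.
  W : ℕ → ℕ → ℚ
  W N zero    = 1ℚ
  W N (suc n) = W N n * ((ι N - ι n) * r (N ℕ.+ n))

  W-vanishes : ∀ N → W N (suc N) ≡ 0ℚ
  W-vanishes N = solve 3 (λ w a r → w :* ((a :- a) :* r) := con 0ℚ) refl (W N N) (ι N) (r (N ℕ.+ N))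

  -- By the factorial form, `W (suc N) n` over `W N n` is (N + 1)²/((N + 1 - n)(N + 1 + n)).
  -- Cross-multiplied, the relation also covers the range where `W` vanishes.
  W-suc : ∀ N n → W (suc N) n * ((ι (suc N) - ι n) * (ι (suc N) + ι n)) ≡ W N n * (ι (suc N) * ι (suc N))
  W-suc N zero    = solve 1 (λ s → con 1ℚ :* ((s :- con 0ℚ) :* (s :+ con 0ℚ)) := con 1ℚ :* (s :* s)) refl (ι (suc N))
  W-suc N (suc n) = begin
    w′ * ((s - b) * ρ) * ((s - ι (suc n)) * (s + ι (suc n)))
      ≡⟨ cong (λ z → w′ * ((s - b) * ρ) * ((s - z) * (s + z))) (ι-suc n) ⟩
    w′ * ((s - b) * ρ) * ((s - (1ℚ + b)) * (s + (1ℚ + b)))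
      ≡⟨ solve 4 (λ w s b ρ → w :* ((s :- b) :* ρ) :* ((s :- (con 1ℚ :+ b)) :* (s :+ (con 1ℚ :+ b)))
           := w :* ((s :- b) :* (s :- (con 1ℚ :+ b))) :* ((con 1ℚ :+ (s :+ b)) :* ρ)) refl w′ s b ρ ⟩
    w′ * ((s - b) * (s - (1ℚ + b))) * ((1ℚ + (s + b)) * ρ)
      -- Both bracketed products equal 1, so the reciprocal belonging to N + 1 is exchanged for the
      -- one belonging to N without dividing.
      ≡⟨ cong (w′ * ((s - b) * (s - (1ℚ + b))) *_) (trans (r[m+n]-inverse (suc N) n) (sym (r[m+n]-inverse N n))) ⟩
    w′ * ((s - b) * (s - (1ℚ + b))) * ((1ℚ + (a + b)) * σ)
      ≡⟨ cong (λ z → w′ * ((z - b) * (z - (1ℚ + b))) * ((1ℚ + (a + b)) * σ)) (ι-suc N) ⟩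
    w′ * ((1ℚ + a - b) * (1ℚ + a - (1ℚ + b))) * ((1ℚ + (a + b)) * σ)
      ≡⟨ solve 4 (λ w a b σ → w :* ((con 1ℚ :+ a :- b) :* (con 1ℚ :+ a :- (con 1ℚ :+ b))) :* ((con 1ℚ :+ (a :+ b)) :* σ)
           := w :* ((con 1ℚ :+ a :- b) :* (con 1ℚ :+ a :+ b)) :* ((a :- b) :* σ)) refl w′ a b σ ⟩
    w′ * ((1ℚ + a - b) * (1ℚ + a + b)) * ((a - b) * σ)
      ≡⟨ cong (λ z → w′ * ((z - b) * (z + b)) * ((a - b) * σ)) (ι-suc N) ⟨
    w′ * ((s - b) * (s + b)) * ((a - b) * σ)
      ≡⟨ cong (_* ((a - b) * σ)) (W-suc N n) ⟩
    W N n * (s * s) * ((a - b) * σ)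
      ≡⟨ solve 3 (λ w s t → w :* (s :* s) :* t := w :* t :* (s :* s)) refl (W N n) s ((a - b) * σ) ⟩
    W N n * ((a - b) * σ) * (s * s)
      ∎
    where
      open ≡-Reasoning
      w′ = W (suc N) n
      s  = ι (suc N)
      a  = ι N
      b  = ι n
      ρ  = r (suc N ℕ.+ n)
      σ  = r (N ℕ.+ n)

  2ℚ : ℚ
  2ℚ = ι 2

  -- For m = n + 1 ≤ N this is ∏ 1/(1 - m²/j²) over j ≤ N with j ≠ m, the constant over 1 - t/m² in
  -- the expansion.
  coefficient : ℕ → ℕ → ℚ
  coefficient N n = [-1]^ n * (2ℚ * W N (suc n))

  -- 2N·W N (n+1) = W N n·(N − n) + W N (n+1)·(N − n − 1), so the signed sum telescopes.
  Σ<-coefficient-telescope : ∀ N m →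
    ι N * Σ< (coefficient N) m ≡ ι N - [-1]^ m * (W N m * (ι N - ι m))
  Σ<-coefficient-telescope N zero    = solve 1 (λ a → a :* con 0ℚ := a :- con 1ℚ :* (con 1ℚ :* (a :- con 0ℚ))) refl (ι N)
  Σ<-coefficient-telescope N (suc m) = begin
    a * (Σ< (coefficient N) m + e * (2ℚ * (w * ((a - b) * ρ))))
      ≡⟨ *-distribˡ-+ a (Σ< (coefficient N) m) _ ⟩
    a * Σ< (coefficient N) m + a * (e * (2ℚ * (w * ((a - b) * ρ))))
      ≡⟨ cong (_+ a * (e * (2ℚ * (w * ((a - b) * ρ))))) (Σ<-coefficient-telescope N m) ⟩
    (a - e * (w * (a - b))) + a * (e * (2ℚ * (w * ((a - b) * ρ))))
      -- A factor 1 is inserted and rewritten as (1 + a + b) ρ. Over the common ρ the terms then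
      -- combine by 2a - (1 + a + b) = a - (1 + b).
      ≡⟨ cong (λ z → (a - e * z) + a * (e * (2ℚ * (w * ((a - b) * ρ))))) (*-identityʳ (w * (a - b))) ⟨
    (a - e * (w * (a - b) * 1ℚ)) + a * (e * (2ℚ * (w * ((a - b) * ρ))))
      ≡⟨ cong (λ z → (a - e * (w * (a - b) * z)) + a * (e * (2ℚ * (w * ((a - b) * ρ))))) (r[m+n]-inverse N m) ⟨
    (a - e * (w * (a - b) * ((1ℚ + (a + b)) * ρ))) + a * (e * (2ℚ * (w * ((a - b) * ρ))))
      ≡⟨ solve 5 (λ a b e w ρ →
           (a :- e :* (w :* (a :- b) :* ((con 1ℚ :+ (a :+ b)) :* ρ))) :+ a :* (e :* (con 2ℚ :* (w :* ((a :- b) :* ρ))))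
           := a :- (con (- 1ℚ) :* e) :* ((w :* ((a :- b) :* ρ)) :* (a :- (con 1ℚ :+ b)))) refl a b e w ρ ⟩
    a - (- 1ℚ * e) * ((w * ((a - b) * ρ)) * (a - (1ℚ + b)))
      ≡⟨ cong (λ z → a - (- 1ℚ * e) * ((w * ((a - b) * ρ)) * (a - z))) (ι-suc m) ⟨
    a - (- 1ℚ * e) * ((w * ((a - b) * ρ)) * (a - ι (suc m)))
      ∎
    where
      open ≡-Reasoning
      a = ι N
      b = ι m
      e = [-1]^ m
      w = W N m
      ρ = r (N ℕ.+ m)

  -- The expansion at t = 0. The boundary term of the telescope contains N + 1 - (N + 1); a positive
  -- cutoff is required to divide by it, and the empty sum is 0.
  Σ<-coefficient : ∀ N → Σ< (coefficient (suc N)) (suc N) ≡ 1ℚ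
  Σ<-coefficient N = begin
    S              ≡⟨ *-identityˡ S ⟨
    1ℚ * S         ≡⟨ cong (_* S) (ι*1/ (suc N)) ⟨
    s * r N * S    ≡⟨ solve 3 (λ s r S → s :* r :* S := r :* (s :* S)) refl s (r N) S ⟩
    r N * (s * S)  ≡⟨ cong (r N *_) (Σ<-coefficient-telescope (suc N) (suc N)) ⟩
    r N * (s - e * (w * (s - s)))
      ≡⟨ solve 4 (λ r s e w → r :* (s :- e :* (w :* (s :- s))) := s :* r) refl (r N) s e w ⟩
    s * r N        ≡⟨ ι*1/ (suc N) ⟩
    1ℚ             ∎
    where
      open ≡-Reasoning
      s = ι (suc N)
      S = Σ< (coefficient (suc N)) (suc N)
      e = [-1]^ (suc N)
      w = W (suc N) (suc N)

  P : ℕ → ℕ → ℚ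
  P n k = 1/ suc n ^ℕ double k

  P-suc : ∀ n k → P n (suc k) ≡ y n * P n k
  P-suc n k = 1/^ℕ-+ (suc n) 2 (double k)

  partialFractions : ℕ → ℕ → ℚ
  partialFractions N k = Σ< (λ n → coefficient N n * P n k) N

  -- Passing from N + 1 to N multiplies the coefficient at m = n + 1 by 1 - m²/(N + 1)², as `W-suc`
  -- shows. Divided by m², this is the recurrence of `h y` at a single pole.
  coefficient-suc : ∀ N n → coefficient (suc N) n * y n ≡ coefficient N n * y n + y N * coefficient (suc N) n
  coefficient-suc N n = begin
    e * (2ℚ * w′) * q
      ≡⟨ *-identityʳ (e * (2ℚ * w′) * q) ⟨
    e * (2ℚ * w′) * q * 1ℚ
      ≡⟨ cong (e * (2ℚ * w′) * q *_) (y-inverse N) ⟨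
    e * (2ℚ * w′) * q * (s * s * p)
      -- The split s² = (s - t)(s + t) + t²: the first part feeds `W-suc`, and the second cancels
      -- against `y n`.
      ≡⟨ solve 6 (λ e w q s t p → e :* (con 2ℚ :* w) :* q :* (s :* s :* p)
           := e :* con 2ℚ :* q :* p :* (w :* ((s :- t) :* (s :+ t))) :+ p :* (e :* (con 2ℚ :* w)) :* (t :* t :* q)) refl e w′ q s t p ⟩
    e * 2ℚ * q * p * (w′ * ((s - t) * (s + t))) + p * (e * (2ℚ * w′)) * (t * t * q)
      ≡⟨ cong₂ (λ f g → e * 2ℚ * q * p * f + p * (e * (2ℚ * w′)) * g) W-suc′ (y-inverse n) ⟩
    e * 2ℚ * q * p * (w * (s * s)) + p * (e * (2ℚ * w′)) * 1ℚ
      ≡⟨ solve 6 (λ e w w′ q s p → e :* con 2ℚ :* q :* p :* (w :* (s :* s)) :+ p :* (e :* (con 2ℚ :* w′)) :* con 1ℚ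
           := e :* (con 2ℚ :* w) :* q :* (s :* s :* p) :+ p :* (e :* (con 2ℚ :* w′))) refl e w w′ q s p ⟩
    e * (2ℚ * w) * q * (s * s * p) + p * (e * (2ℚ * w′))
      ≡⟨ cong (λ z → e * (2ℚ * w) * q * z + p * (e * (2ℚ * w′))) (y-inverse N) ⟩
    e * (2ℚ * w) * q * 1ℚ + p * (e * (2ℚ * w′))
      ≡⟨ cong (_+ p * (e * (2ℚ * w′))) (*-identityʳ (e * (2ℚ * w) * q)) ⟩
    e * (2ℚ * w) * q + p * (e * (2ℚ * w′))
      ∎
    where
      open ≡-Reasoning
      e  = [-1]^ n
      w′ = W (suc N) (suc n)
      w  = W N (suc n)
      q  = y n
      p  = y N
      s  = 1ℚ + ι N
      t  = 1ℚ + ι n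
      W-suc′ : w′ * ((s - t) * (s + t)) ≡ w * (s * s)
      W-suc′ = subst₂ (λ s t → w′ * ((s - t) * (s + t)) ≡ w * (s * s)) (ι-suc N) (ι-suc n) (W-suc N (suc n))

  partialFractions-suc : ∀ N k → partialFractions (suc N) (suc k) ≡
    partialFractions N (suc k) + y N * partialFractions (suc N) k
  partialFractions-suc N k = begin
    Σ< (λ n → coefficient (suc N) n * P n (suc k)) (suc N)
      ≡⟨ Σ<-cong term (suc N) ⟩
    Σ< (λ n → coefficient N n * P n (suc k) + y N * (coefficient (suc N) n * P n k)) (suc N)
      ≡⟨ Σ<-+* (λ n → coefficient N n * P n (suc k)) (y N) (λ n → coefficient (suc N) n * P n k) (suc N) ⟩
    Σ< (λ n → coefficient N n * P n (suc k)) (suc N) + y N * partialFractions (suc N) k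
      -- The sum for cutoff N has been extended by one term, which contains `W N (suc N)`.
      ≡⟨ cong (_+ y N * partialFractions (suc N) k) last-vanishes ⟩
    partialFractions N (suc k) + y N * partialFractions (suc N) k
      ∎
    where
      open ≡-Reasoning
      term : ∀ n → coefficient (suc N) n * P n (suc k) ≡
                   coefficient N n * P n (suc k) + y N * (coefficient (suc N) n * P n k)
      term n = begin
        c′ * P n (suc k)                    ≡⟨ cong (c′ *_) (P-suc n k) ⟩
        c′ * (y n * P n k)                  ≡⟨ *-assoc c′ (y n) (P n k) ⟨
        c′ * y n * P n k                    ≡⟨ cong (_* P n k) (coefficient-suc N n) ⟩
        (c * y n + y N * c′) * P n k        ≡⟨ solve 5 (λ c c′ a b p → (c :* a :+ b :* c′) :* p := c :* (a :* p) :+ b :* (c′ :* p)) refl c c′ (y n) (y N) (P n k) ⟩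
        c * (y n * P n k) + y N * (c′ * P n k)  ≡⟨ cong (λ z → c * z + y N * (c′ * P n k)) (P-suc n k) ⟨
        c * P n (suc k) + y N * (c′ * P n k)    ∎
        where
          c  = coefficient N n
          c′ = coefficient (suc N) n
      last-vanishes : partialFractions N (suc k) + coefficient N N * P N (suc k) ≡ partialFractions N (suc k)
      last-vanishes = begin
        partialFractions N (suc k) + [-1]^ N * (2ℚ * W N (suc N)) * P N (suc k)
          ≡⟨ cong (λ z → partialFractions N (suc k) + [-1]^ N * (2ℚ * z) * P N (suc k)) (W-vanishes N) ⟩
        partialFractions N (suc k) + [-1]^ N * (2ℚ * 0ℚ) * P N (suc k)
          ≡⟨ solve 3 (λ f e p → f :+ e :* (con 2ℚ :* con 0ℚ) :* p := f) refl (partialFractions N (suc k)) ([-1]^ N) (P N (suc k)) ⟩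
        partialFractions N (suc k)
          ∎

  -- Both sides obey one recurrence. Degree 0 is excluded because at N = 0 it would compare 1 with
  -- an empty sum; the recurrence meets degree 0 only at `suc N`, where `Σ<-coefficient` applies.
  h-partialFractions : ∀ k N → h y (suc k) N ≡ partialFractions N (suc k)
  h-partialFractions k zero = refl
  h-partialFractions k (suc N) = trans
    (cong₂ (λ p q → p + y N * q) (h-partialFractions k N) (step k))
    (sym (partialFractions-suc N k))
    where
      step : ∀ k → h y k (suc N) ≡ partialFractions (suc N) k
      step zero    = sym (trans (Σ<-cong (λ n → *-identityʳ (coefficient (suc N) n)) (suc N)) (Σ<-coefficient N))
      step (suc k) = h-partialFractions k (suc N)

-- Defect of the coefficients, and the alternating zeta series.

module AlternatingZeta where
  open import Data.Nat.Base as ℕ using (ℕ; zero; suc; ⌊_/2⌋)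
  import Data.Nat.Properties as ℕ
  open import Data.Product.Base using (∃-syntax; _,_)
  open import Data.Rational.Base hiding (1/_)
  open import Data.Rational.Properties
  open import Data.Rational.Solver using (module +-*-Solver)
  open import Data.Sum.Base using (_⊎_; inj₁; inj₂)
  open import Relation.Binary.PropositionalEquality
  open Arithmetic
  open SymmetricPolynomials
  open Asymptotics
  open PartialFractions
  open +-*-Solver using (solve; con; _:+_; _:*_; _:-_; :-_; _:=_)

  ι-nonNeg : ∀ n → 0ℚ ≤ ι n
  ι-nonNeg n = nonNegative⁻¹ _ {{normalize-nonNeg n 1}}

  ι-mono : ∀ {m n} → m ℕ.≤ n → ι m ≤ ι n
  ι-mono {m} {n} m≤n = subst (ι m ≤_)
    (trans (sym (ι-+ m (n ℕ.∸ m))) (cong ι (ℕ.m+[n∸m]≡n m≤n)))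
    (p≤p+q (ι m) (ι-nonNeg (n ℕ.∸ m)))

  p≤q⇒0≤q-p : ∀ {p q} → p ≤ q → 0ℚ ≤ q - p
  p≤q⇒0≤q-p {p} {q} p≤q = subst (_≤ q - p) (+-inverseʳ p) (+-monoˡ-≤ (- p) p≤q)

  0≤q-p⇒p≤q : ∀ {p q} → 0ℚ ≤ q - p → p ≤ q
  0≤q-p⇒p≤q {p} {q} 0≤q-p = subst (p ≤_) (sym (sub-add q p)) (p≤q+p p 0≤q-p)

  -- From 1 - (N - n)/(N + n + 1) = (2n + 1)/(N + n + 1).
  W-suc-defect : ∀ N n → 1ℚ - W N (suc n) ≡ (1ℚ - W N n) + W N n * ((ι n + (1ℚ + ι n)) * r (N ℕ.+ n))
  W-suc-defect N n = begin
    1ℚ - w * ((a - b) * ρ)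
      ≡⟨ solve 4 (λ w a b ρ → con 1ℚ :- w :* ((a :- b) :* ρ)
           := (con 1ℚ :- w :* ((con 1ℚ :+ (a :+ b)) :* ρ)) :+ w :* ((b :+ (con 1ℚ :+ b)) :* ρ)) refl w a b ρ ⟩
    (1ℚ - w * ((1ℚ + (a + b)) * ρ)) + w * ((b + (1ℚ + b)) * ρ)
      ≡⟨ cong (λ z → (1ℚ - w * z) + w * ((b + (1ℚ + b)) * ρ)) (r[m+n]-inverse N n) ⟩
    (1ℚ - w * 1ℚ) + w * ((b + (1ℚ + b)) * ρ)
      ≡⟨ cong (λ z → (1ℚ - z) + w * ((b + (1ℚ + b)) * ρ)) (*-identityʳ w) ⟩
    (1ℚ - w) + w * ((b + (1ℚ + b)) * ρ)
      ∎
    where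
      open ≡-Reasoning
      w = W N n
      a = ι N
      b = ι n
      ρ = r (N ℕ.+ n)

  W-nonNeg : ∀ N {n} → n ℕ.≤ N → 0ℚ ≤ W N n
  W-nonNeg N {zero}  _   = nonNegative⁻¹ 1ℚ
  W-nonNeg N {suc n} n<N = *-nonNeg (W-nonNeg N (ℕ.<⇒≤ n<N))
    (*-nonNeg (p≤q⇒0≤q-p (ι-mono (ℕ.<⇒≤ n<N))) (r-nonNeg (N ℕ.+ n)))

  n+[1+n]-nonNeg : ∀ n → 0ℚ ≤ ι n + (1ℚ + ι n)
  n+[1+n]-nonNeg n = ≤-trans (ι-nonNeg n)
    (p≤p+q (ι n) (≤-trans (ι-nonNeg n) (p≤q+p (ι n) (nonNegative⁻¹ 1ℚ))))

  step-nonNeg : ∀ N n → 0ℚ ≤ (ι n + (1ℚ + ι n)) * r (N ℕ.+ n)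
  step-nonNeg N n = *-nonNeg (n+[1+n]-nonNeg n) (r-nonNeg (N ℕ.+ n))

  0≤1-W : ∀ N {n} → n ℕ.≤ N → 0ℚ ≤ 1ℚ - W N n
  0≤1-W N {zero}  _   = ≤-refl
  0≤1-W N {suc n} n<N = subst (0ℚ ≤_) (sym (W-suc-defect N n))
    (≤-trans (0≤1-W N (ℕ.<⇒≤ n<N))
      (p≤p+q (1ℚ - W N n) (*-nonNeg (W-nonNeg N (ℕ.<⇒≤ n<N)) (step-nonNeg N n))))

  -- Each step adds at most (2n + 1)/(N + 1), by `W-suc-defect` and `W N n` ≤ 1, and consecutive odd
  -- numbers sum to a square.
  1-W≤n²/N : ∀ N {n} → n ℕ.≤ N → 1ℚ - W N n ≤ ι n * ι n * r N
  1-W≤n²/N N {zero}  _   = ≤-reflexive (solve 1 (λ r → con 0ℚ := con 0ℚ :* con 0ℚ :* r) refl (r N))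
  1-W≤n²/N N {suc n} n<N = begin
    1ℚ - W N (suc n)
      ≡⟨ W-suc-defect N n ⟩
    (1ℚ - W N n) + W N n * ((b + (1ℚ + b)) * r (N ℕ.+ n))
      ≤⟨ +-mono-≤ (1-W≤n²/N N (ℕ.<⇒≤ n<N)) (begin
        W N n * ((b + (1ℚ + b)) * r (N ℕ.+ n))
          ≤⟨ *-monoʳ-≤-nonNeg ((b + (1ℚ + b)) * r (N ℕ.+ n)) {{nonNegative (step-nonNeg N n)}} (0≤q-p⇒p≤q {W N n} {1ℚ} (0≤1-W N (ℕ.<⇒≤ n<N))) ⟩
        1ℚ * ((b + (1ℚ + b)) * r (N ℕ.+ n))
          ≡⟨ *-identityˡ ((b + (1ℚ + b)) * r (N ℕ.+ n)) ⟩
        (b + (1ℚ + b)) * r (N ℕ.+ n)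
          ≤⟨ *-monoˡ-≤-nonNeg (b + (1ℚ + b)) {{nonNegative (n+[1+n]-nonNeg n)}} (1/-antimono (ℕ.m≤m+n N n)) ⟩
        (b + (1ℚ + b)) * r N ∎) ⟩
    b * b * r N + (b + (1ℚ + b)) * r N
      ≡⟨ solve 2 (λ b r → b :* b :* r :+ (b :+ (con 1ℚ :+ b)) :* r := (con 1ℚ :+ b) :* (con 1ℚ :+ b) :* r) refl b (r N) ⟩
    (1ℚ + b) * (1ℚ + b) * r N
      ≡⟨ cong (λ z → z * z * r N) (ι-suc n) ⟨
    ι (suc n) * ι (suc n) * r N
      ∎
    where
      open ≤-Reasoning
      b = ι n

  ∣[-1]^n*p∣ : ∀ n p → ∣ [-1]^ n * p ∣ ≡ ∣ p ∣
  ∣[-1]^n*p∣ zero    p = cong ∣_∣ (*-identityˡ p)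
  ∣[-1]^n*p∣ (suc n) p = trans
    (cong ∣_∣ (solve 2 (λ e p → (con (- 1ℚ) :* e) :* p := :- (e :* p)) refl ([-1]^ n) p))
    (trans (∣-p∣≡∣p∣ ([-1]^ n * p)) (∣[-1]^n*p∣ n p))

  -- Partial sums of the Dirichlet eta function.
  η : ℕ → ℕ → ℚ
  η s = Σ< (λ n → [-1]^ n * 1/ suc n ^ℕ s)

  -- The defect at n + 1 is at most (n + 1)²/(N + 1), which lowers the exponent by two. The bound
  -- tends to 0 for k ≥ 1; at k = 0 the sum on the right is N and there is no decay.
  partialFractions-close : ∀ k N →
    ∣ partialFractions N (suc k) - 2ℚ * η (double (suc k)) N ∣ ≤ 2ℚ * (r N * partialζ (double k) N)
  partialFractions-close k N = begin
    ∣ partialFractions N (suc k) - 2ℚ * η (double (suc k)) N ∣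
      ≡⟨ cong (λ z → ∣ partialFractions N (suc k) - z ∣) (Σ<-* 2ℚ (λ n → [-1]^ n * P n (suc k)) N) ⟨
    ∣ partialFractions N (suc k) - Σ< (λ n → 2ℚ * ([-1]^ n * P n (suc k))) N ∣
      ≤⟨ Σ<-close N term ⟩
    Σ< (λ n → 2ℚ * (r N * P n k)) N
      ≡⟨ Σ<-* 2ℚ (λ n → r N * P n k) N ⟩
    2ℚ * Σ< (λ n → r N * P n k) N
      ≡⟨ cong (2ℚ *_) (Σ<-* (r N) (λ n → P n k) N) ⟩
    2ℚ * (r N * Σ< (λ n → P n k) N)
      ≡⟨ cong (λ z → 2ℚ * (r N * z)) (partialζ≡Σ< (double k) N) ⟨
    2ℚ * (r N * partialζ (double k) N)
      ∎
    where
      open ≤-Reasoning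
      term : ∀ n → n ℕ.< N →
        ∣ coefficient N n * P n (suc k) - 2ℚ * ([-1]^ n * P n (suc k)) ∣ ≤ 2ℚ * (r N * P n k)
      term n n<N = begin
        ∣ e * (2ℚ * w) * p′ - 2ℚ * (e * p′) ∣
          ≡⟨ cong ∣_∣ (solve 3 (λ e w p → e :* (con 2ℚ :* w) :* p :- con 2ℚ :* (e :* p)
               := e :* (:- (con 2ℚ :* ((con 1ℚ :- w) :* p)))) refl e w p′) ⟩
        ∣ e * - (2ℚ * ((1ℚ - w) * p′)) ∣
          ≡⟨ ∣[-1]^n*p∣ n (- (2ℚ * ((1ℚ - w) * p′))) ⟩
        ∣ - (2ℚ * ((1ℚ - w) * p′)) ∣
          ≡⟨ ∣-p∣≡∣p∣ (2ℚ * ((1ℚ - w) * p′)) ⟩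
        ∣ 2ℚ * ((1ℚ - w) * p′) ∣
          ≡⟨ 0≤p⇒∣p∣≡p (*-nonNeg (nonNegative⁻¹ 2ℚ) (*-nonNeg (0≤1-W N n<N) (1/n^s-nonNeg n (double (suc k))))) ⟩
        2ℚ * ((1ℚ - w) * p′)
          ≤⟨ *-monoˡ-≤-nonNeg 2ℚ (*-monoʳ-≤-nonNeg p′ {{nonNegative (1/n^s-nonNeg n (double (suc k)))}} (1-W≤n²/N N n<N)) ⟩
        2ℚ * (ι (suc n) * ι (suc n) * r N * p′)
          ≡⟨ cong₂ (λ f g → 2ℚ * (f * f * r N * g)) (ι-suc n) (P-suc n k) ⟩
        2ℚ * (t * t * r N * (y n * p))
          ≡⟨ solve 4 (λ t r y p → con 2ℚ :* (t :* t :* r :* (y :* p)) := con 2ℚ :* ((t :* t :* y) :* (r :* p))) refl t (r N) (y n) p ⟩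
        2ℚ * ((t * t * y n) * (r N * p))
          ≡⟨ cong (λ z → 2ℚ * (z * (r N * p))) (y-inverse n) ⟩
        2ℚ * (1ℚ * (r N * p))
          ≡⟨ cong (2ℚ *_) (*-identityˡ (r N * p)) ⟩
        2ℚ * (r N * p)
          ∎
        where
          e  = [-1]^ n
          w  = W N (suc n)
          p′ = P n (suc k)
          p  = P n k
          t  = 1ℚ + ι n

  [-1]^double : ∀ m → [-1]^ double m ≡ 1ℚ
  [-1]^double zero    = refl
  [-1]^double (suc m) = trans
    (solve 1 (λ e → con (- 1ℚ) :* (con (- 1ℚ) :* e) := e) refl ([-1]^ double m)) ([-1]^double m)

  ⌊double/2⌋ : ∀ m → ⌊ double m /2⌋ ≡ m
  ⌊double/2⌋ zero    = refl
  ⌊double/2⌋ (suc m) = cong suc (⌊double/2⌋ m)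

  ⌊1+double/2⌋ : ∀ m → ⌊ suc (double m) /2⌋ ≡ m
  ⌊1+double/2⌋ zero    = refl
  ⌊1+double/2⌋ (suc m) = cong suc (⌊1+double/2⌋ m)

  parity : ∀ n → (∃[ m ] n ≡ double m) ⊎ (∃[ m ] n ≡ suc (double m))
  parity zero = inj₁ (0 , refl)
  parity (suc n) with parity n
  ... | inj₁ (m , refl) = inj₂ (m , refl)
  ... | inj₂ (m , refl) = inj₁ (suc m , refl)

  -- The signs subtract every even term twice, and 1/(2j)ˢ = 2⁻ˢ/jˢ.
  η-double : ∀ s m → η s (double m) ≡ partialζ s (double m) - 2ℚ * ((1/ 2 ^ℕ s) * partialζ s m)
  η-double s zero    = solve 1 (λ c → con 0ℚ := con 0ℚ :- con 2ℚ :* (c :* con 0ℚ)) refl (1/ 2 ^ℕ s)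
  η-double s (suc m) = begin
    η s (double m) + e * p + (- 1ℚ * e) * q
      ≡⟨ cong₂ (λ f g → f + g * p + (- 1ℚ * g) * q) (η-double s m) ([-1]^double m) ⟩
    (Z - 2ℚ * (c * z)) + 1ℚ * p + (- 1ℚ * 1ℚ) * q
      ≡⟨ solve 5 (λ Z c z p q → (Z :- con 2ℚ :* (c :* z)) :+ con 1ℚ :* p :+ (con (- 1ℚ) :* con 1ℚ) :* q
           := (Z :+ p :+ q) :- con 2ℚ :* (c :* z :+ q)) refl Z c z p q ⟩
    (Z + p + q) - 2ℚ * (c * z + q)
      ≡⟨ cong (λ f → (Z + p + q) - 2ℚ * (c * z + f)) q≡ ⟩
    (Z + p + q) - 2ℚ * (c * z + c * t)
      ≡⟨ cong (λ f → (Z + p + q) - 2ℚ * f) (*-distribˡ-+ c z t) ⟨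
    (Z + p + q) - 2ℚ * (c * (z + t))
      ∎
    where
      open ≡-Reasoning
      e = [-1]^ double m
      p = 1/ suc (double m) ^ℕ s
      q = 1/ suc (suc (double m)) ^ℕ s
      c = 1/ 2 ^ℕ s
      t = 1/ suc m ^ℕ s
      Z = partialζ s (double m)
      z = partialζ s m
      q≡ : q ≡ c * t
      q≡ = trans (1/^ℕ-cong s (double≡2* (suc m))) (1/^ℕ-* 2 (suc m) s)

  η-formula : ∀ s n → η s n ≡ partialζ s n - 2ℚ * ((1/ 2 ^ℕ s) * partialζ s ⌊ n /2⌋)
  η-formula s n with parity n
  ... | inj₁ (m , refl) = trans (η-double s m)
    (cong (λ i → partialζ s (double m) - 2ℚ * ((1/ 2 ^ℕ s) * partialζ s i)) (sym (⌊double/2⌋ m)))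
  ... | inj₂ (m , refl) = begin
    η s (double m) + [-1]^ double m * p
      ≡⟨ cong₂ (λ f g → f + g * p) (η-double s m) ([-1]^double m) ⟩
    (Z - d) + 1ℚ * p
      ≡⟨ solve 3 (λ Z d p → (Z :- d) :+ con 1ℚ :* p := (Z :+ p) :- d) refl Z d p ⟩
    (Z + p) - d
      ≡⟨ cong (λ i → (Z + p) - 2ℚ * ((1/ 2 ^ℕ s) * partialζ s i)) (⌊1+double/2⌋ m) ⟨
    (Z + p) - 2ℚ * ((1/ 2 ^ℕ s) * partialζ s ⌊ suc (double m) /2⌋)
      ∎
    where
      open ≡-Reasoning
      p = 1/ suc (double m) ^ℕ s
      Z = partialζ s (double m)
      d = 2ℚ * ((1/ 2 ^ℕ s) * partialζ s m)

-- Closed formulas for the exponents 2^t, and the explicit one for 4.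

module Evaluation where
  import Data.Integer.Base as ℤ
  import Data.Integer.Properties as ℤ
  open import Data.List.Base using (foldr; applyUpTo)
  open import Data.Nat.Base as ℕ using (ℕ; zero; suc; ⌊_/2⌋; _∸_)
  import Data.Nat.Properties as ℕ
  open import Data.Rational.Base hiding (1/_)
  open import Data.Rational.Properties
  open import Data.Rational.Solver using (module +-*-Solver)
  open import Function.Base using (_∘_)
  open import Relation.Binary.PropositionalEquality
  open Arithmetic
  open SymmetricPolynomials
  open Asymptotics
  open PartialFractions
  open AlternatingZeta
  open +-*-Solver using (solve; con; _:+_; _:*_; _:-_; :-_; _:=_)

  partialFractions∼2η : ∀ k → (λ N → partialFractions N (suc (suc k))) ∼ (λ N → 2ℚ * η (double (suc (suc k))) N)
  partialFractions∼2η k = ∼-squeeze (partialFractions-close (suc k))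
    (∼-* (fromℚ 2ℚ) (fromℚ 0ℚ *ᴿ Z) (∼-refl (λ _ → 2ℚ)) (∼-* (fromℚ 0ℚ) Z 1/n∼0 (∼-refl (seq Z))))
    (λ n → solve 1 (λ z → con 2ℚ :* (con 0ℚ :* z) := con 0ℚ) refl (seq Z n))
    where Z = ζ (double (suc k))

  -- In `η-formula` the index ⌊n/2⌋ may be replaced by n in the limit, which leaves the factor 2 (1
  -- - 2 · 2⁻ˢ).
  2η∼ζ : ∀ s → (λ N → 2ℚ * η (suc (suc s)) N) ∼ (λ N → (2ℚ - ι 4 * (1/ 2 ^ℕ suc (suc s))) * seq (ζ (suc (suc s))) N)
  2η∼ζ s = ∼-resp-≗
    (λ n → trans (solve 3 (λ z c z′ → con 2ℚ :* z :+ (:- (con (ι 4) :* c)) :* z′ := con 2ℚ :* (z :- con 2ℚ :* (c :* z′))) refl (seq Z n) c (seq Z ⌊ n /2⌋))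
                 (cong (2ℚ *_) (sym (η-formula (suc (suc s)) n))))
    (λ n → solve 2 (λ z c → con 2ℚ :* z :+ (:- (con (ι 4) :* c)) :* z := (con 2ℚ :- con (ι 4) :* c) :* z) refl (seq Z n) c)
    (∼-+ (∼-* (fromℚ 2ℚ) Z (∼-refl (λ _ → 2ℚ)) (∼-refl (seq Z)))
         (∼-* (fromℚ (- (ι 4 * c))) Z (∼-refl (λ _ → - (ι 4 * c))) (∼-halve Z)))
    where
      Z = ζ (suc (suc s))
      c = 1/ 2 ^ℕ suc (suc s)

  -- The exponent is an integer, so that k = 0 gives 2⁻¹ - 1 = -1/2.
  2^[2*_-1]-1 : ℕ → ℚ
  2^[2* k -1]-1 = 2^ (ℤ.+ (2 ℕ.* k) ℤ.- ℤ.+ 1) - 1ℚ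

  -- Equal to 2 - 4 · 2⁻²ᵏ for k > 0, but arranged around the factor 2²ᵏ⁻¹ - 1 of the target
  -- formula.
  ζ𝒫₂-factor : ℕ → ℚ
  ζ𝒫₂-factor k = ι 4 * (1/ 2 ^ℕ double k) * 2^[2* k -1]-1

  ζ𝒫₂-factor-suc : ∀ k → ζ𝒫₂-factor (suc k) ≡ 2ℚ - ι 4 * (1/ 2 ^ℕ double (suc k))
  ζ𝒫₂-factor-suc k = begin
    ι 4 * c * (p - 1ℚ)              ≡⟨ solve 2 (λ c p → con (ι 4) :* c :* (p :- con 1ℚ) := con 2ℚ :* ((con 2ℚ :* p) :* c) :- con (ι 4) :* c) refl c p ⟩
    2ℚ * ((2ℚ * p) * c) - ι 4 * c   ≡⟨ cong (λ z → 2ℚ * (z * c) - ι 4 * c) 2p≡ ⟩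
    2ℚ * (ι (2 ℕ.^ double (suc k)) * c) - ι 4 * c ≡⟨ cong (λ z → 2ℚ * z - ι 4 * c) (1/^ℕ-inverse 2 (double (suc k))) ⟩
    2ℚ * 1ℚ - ι 4 * c               ≡⟨⟩
    2ℚ - ι 4 * c                    ∎
    where
      open ≡-Reasoning
      c = 1/ 2 ^ℕ double (suc k)
      p = ι (2 ℕ.^ (k ℕ.+ suc (k ℕ.+ 0)))
      2p≡ : 2ℚ * p ≡ ι (2 ℕ.^ double (suc k))
      2p≡ = trans (sym (ι-* 2 (2 ℕ.^ (k ℕ.+ suc (k ℕ.+ 0))))) (cong (λ i → ι (2 ℕ.^ i)) (sym (double≡2* (suc k))))

  -- Degree 1 is treated apart because the error bound for the partial fractions does not decay
  -- there; the factor is then 1 and `h` is the partial sum of ζ(2).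
  h∼ζ[2*] : ∀ k → h y k ∼ seq (fromℚ (ζ𝒫₂-factor k) *ᴿ ζ (2 ℕ.* k))
  -- The factor is -2 and ζ(0) = -1/2, so the product computes to 1.
  h∼ζ[2*] zero       = ∼-refl (λ _ → 1ℚ)
  h∼ζ[2*] (suc zero) = ∼-resp-≗ h₁ (λ n → sym (*-identityˡ (partialζ 2 n))) (∼-refl (partialζ 2))
    where
      h₁ : partialζ 2 ≗ h y 1
      h₁ zero    = refl
      h₁ (suc N) = cong₂ _+_ (h₁ N) (sym (*-identityʳ (y N)))
  h∼ζ[2*] (suc (suc k)) = ∼-resp-≗
    (λ N → sym (h-partialFractions (suc k) N))
    (λ N → cong₂ _*_ (sym (ζ𝒫₂-factor-suc (suc k))) (cong (λ s → seq (ζ s) N) (double≡2* (suc (suc k)))))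
    (∼-trans (partialFractions∼2η k) (2η∼ζ (double (suc k))))

  signedᶠ : (ℕ → Formula) → ℕ → Formula
  signedᶠ a i = const ([-1]^ i) ⊗ a i

  -- The formula for ζ_𝒫({2^(t + 1)}^k).
  ζ𝒫-formula : ℕ → ℕ → Formula
  ζ𝒫-formula zero    k = const (ζ𝒫₂-factor k) ⊗ ζ[2* k ]
  ζ𝒫-formula (suc t) k = convolutionᶠ (signedᶠ (ζ𝒫-formula t)) (ζ𝒫-formula t) (double k)

  h∼ζ𝒫-formula : ∀ t k → h (λ n → 1/ suc n ^ℕ (2 ℕ.^ suc t)) k ∼ seq ⟦ ζ𝒫-formula t k ⟧
  h∼ζ𝒫-formula zero    k = h∼ζ[2*] k
  h∼ζ𝒫-formula (suc t) k = ∼-resp-≗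
    (λ N → trans (sym (h-square x k N)) (h-cong (λ n → sym (x-square n)) k N))
    (λ _ → refl)
    (∼-convolution (signedᶠ f) f
      (λ i → ∼-* (fromℚ ([-1]^ i)) ⟦ f i ⟧ (∼-refl (λ _ → [-1]^ i)) (h∼ζ𝒫-formula t i))
      (h∼ζ𝒫-formula t) (double k))
    where
      f = ζ𝒫-formula t
      x = λ n → 1/ suc n ^ℕ (2 ℕ.^ suc t)
      x-square : ∀ n → 1/ suc n ^ℕ (2 ℕ.^ suc (suc t)) ≡ x n * x n
      x-square n = trans
        (cong (λ s → 1/ suc n ^ℕ (2 ℕ.^ suc t ℕ.+ s)) (ℕ.+-identityʳ (2 ℕ.^ suc t)))
        (1/^ℕ-+ (suc n) (2 ℕ.^ suc t) (2 ℕ.^ suc t))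

  seq-foldr : ∀ g m N → seq (foldr _+ᴿ_ (fromℚ 0ℚ) (applyUpTo g m)) N ≡ foldr _+_ 0ℚ (applyUpTo (λ i → seq (g i) N) m)
  seq-foldr g zero    N = refl
  seq-foldr g (suc m) N = cong (λ z → seq (g 0) N + z) (seq-foldr (g ∘ suc) m N)

  *-distribˡ-foldr : ∀ q f m → q * foldr _+_ 0ℚ (applyUpTo f m) ≡ foldr _+_ 0ℚ (applyUpTo (λ i → q * f i) m)
  *-distribˡ-foldr q f zero    = *-zeroʳ q
  *-distribˡ-foldr q f (suc m) = trans (*-distribˡ-+ q (f 0) (foldr _+_ 0ℚ (applyUpTo (f ∘ suc) m)))
    (cong (λ z → q * f 0 + z) (*-distribˡ-foldr q (f ∘ suc) m))

  double-+ : ∀ i j → double (i ℕ.+ j) ≡ double i ℕ.+ double j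
  double-+ zero    j = refl
  double-+ (suc i) j = cong (suc ∘ suc) (double-+ i j)

  convolution≡seq-Σᴿ : ∀ {a b} q g m N → (∀ i → i ℕ.≤ m → q * seq (g i) N ≡ a i * b (m ∸ i)) →
    convolution a b m ≡ seq (fromℚ q *ᴿ (Σᴿ[ 0 ⋯ m ] g)) N
  convolution≡seq-Σᴿ {a} {b} q g m N term = begin
    convolution a b m
      ≡⟨ convolution≡foldr (λ i → q * seq (g i) N) term ⟩
    foldr _+_ 0ℚ (applyUpTo (λ i → q * seq (g i) N) (suc m))
      ≡⟨ *-distribˡ-foldr q (λ i → seq (g i) N) (suc m) ⟨
    q * foldr _+_ 0ℚ (applyUpTo (λ i → seq (g i) N) (suc m))
      ≡⟨ cong (q *_) (seq-foldr g (suc m) N) ⟨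
    seq (fromℚ q *ᴿ (Σᴿ[ 0 ⋯ m ] g)) N
      ∎
    where open ≡-Reasoning

  1/16^ℕ : ∀ k → 0 ℕ.< k → 1/ 16 ^ℕ (k ∸ 1) ≡ ι 16 * (1/ 2 ^ℕ double (double k))
  1/16^ℕ (suc zero)    _ = refl
  1/16^ℕ (suc (suc k)) _ = begin
    1/ 16 ^ℕ suc k                  ≡⟨ 1/^ℕ-+ 16 1 k ⟩
    (1/ 2 ^ℕ 4) * (1/ 16 ^ℕ k)      ≡⟨ cong ((1/ 2 ^ℕ 4) *_) (1/16^ℕ (suc k) ℕ.z<s) ⟩
    (1/ 2 ^ℕ 4) * (ι 16 * c)        ≡⟨ solve 1 (λ c → con (1/ 2 ^ℕ 4) :* (con (ι 16) :* c) := con (ι 16) :* (con (1/ 2 ^ℕ 4) :* c)) refl c ⟩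
    ι 16 * ((1/ 2 ^ℕ 4) * c)        ≡⟨ cong (ι 16 *_) (1/^ℕ-+ 2 4 (double (double (suc k)))) ⟨
    ι 16 * (1/ 2 ^ℕ double (double (suc (suc k)))) ∎
    where
      open ≡-Reasoning
      c = 1/ 2 ^ℕ double (double (suc k))

  4*k∸2*i : ∀ k i → 4 ℕ.* k ∸ 2 ℕ.* i ≡ 2 ℕ.* (2 ℕ.* k ∸ i)
  4*k∸2*i k i = trans (cong (_∸ 2 ℕ.* i) (ℕ.*-assoc 2 2 k)) (sym (ℕ.*-distribˡ-∸ 2 (2 ℕ.* k) i))

  -- The exponent of 2 subtracts in ℤ, the argument of ζ by truncation in ℕ. For i ≤ 2k both give
  -- the same number.
  +4*k-2*i : ∀ k i → i ℕ.≤ 2 ℕ.* k → ℤ.+ (4 ℕ.* k) ℤ.- ℤ.+ (2 ℕ.* i) ≡ ℤ.+ (2 ℕ.* (2 ℕ.* k ∸ i))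
  +4*k-2*i k i i≤2k = trans (ℤ.m-n≡m⊖n (4 ℕ.* k) (2 ℕ.* i)) (trans
    (ℤ.⊖-≥ (subst (2 ℕ.* i ℕ.≤_) (sym (ℕ.*-assoc 2 2 k)) (ℕ.*-monoʳ-≤ 2 i≤2k)))
    (cong ℤ.+_ (4*k∸2*i k i)))

  -- Origin of the prefactor: 4 · 2⁻²ⁱ times 4 · 2⁻²ʲ with i + j = 2k is 16 · 2⁻⁴ᵏ, independent of
  -- i. Positivity of k makes `k ∸ 1` a true predecessor.
  ζ𝒫₂-factor-* : ∀ k → 0 ℕ.< k → ∀ i → i ℕ.≤ 2 ℕ.* k → ζ𝒫₂-factor i * ζ𝒫₂-factor (2 ℕ.* k ∸ i) ≡
    (1/ 16 ^ℕ (k ∸ 1)) * (2^[2* i -1]-1 * 2^[2* 2 ℕ.* k ∸ i -1]-1)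
  ζ𝒫₂-factor-* k 0<k i i≤2k = begin
    ι 4 * u * d * (ι 4 * v * d′)
      ≡⟨ solve 4 (λ u v d d′ → con (ι 4) :* u :* d :* (con (ι 4) :* v :* d′) := con (ι 16) :* (u :* v) :* (d :* d′)) refl u v d d′ ⟩
    ι 16 * (u * v) * (d * d′)
      ≡⟨ cong (λ z → ι 16 * z * (d * d′)) (1/^ℕ-+ 2 (double i) (double j)) ⟨
    ι 16 * (1/ 2 ^ℕ (double i ℕ.+ double j)) * (d * d′)
      ≡⟨ cong (λ s → ι 16 * (1/ 2 ^ℕ s) * (d * d′)) exponent ⟩
    ι 16 * (1/ 2 ^ℕ double (double k)) * (d * d′)
      ≡⟨ cong (_* (d * d′)) (1/16^ℕ k 0<k) ⟨
    (1/ 16 ^ℕ (k ∸ 1)) * (d * d′)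
      ∎
    where
      open ≡-Reasoning
      j  = 2 ℕ.* k ∸ i
      u  = 1/ 2 ^ℕ double i
      v  = 1/ 2 ^ℕ double j
      d  = 2^[2* i -1]-1
      d′ = 2^[2* j -1]-1
      exponent : double i ℕ.+ double j ≡ double (double k)
      exponent = trans (sym (double-+ i j)) (cong double (trans (ℕ.m+[n∸m]≡n i≤2k) (sym (double≡2* k))))

  -- Spelled as in the theorem, so that `ζ𝒫₄` unfolds to its right-hand side.
  ζ𝒫₄-summand : ℕ → ℕ → ℝ
  ζ𝒫₄-summand k n =
    fromℚ ([-1]^ n * (2^ (ℤ.+ (2 ℕ.* n) ℤ.- ℤ.+ 1) - 1ℚ) * (2^ (ℤ.+ (4 ℕ.* k) ℤ.- ℤ.+ (2 ℕ.* n) ℤ.- ℤ.+ 1) - 1ℚ))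
      *ᴿ ζ (2 ℕ.* n) *ᴿ ζ (4 ℕ.* k ∸ 2 ℕ.* n)

  seq-ζ𝒫₄-summand : ∀ k → 0 ℕ.< k → ∀ N i → i ℕ.≤ 2 ℕ.* k → (1/ 16 ^ℕ (k ∸ 1)) * seq (ζ𝒫₄-summand k i) N ≡
    seq ⟦ signedᶠ (ζ𝒫-formula 0) i ⟧ N * seq ⟦ ζ𝒫-formula 0 (2 ℕ.* k ∸ i) ⟧ N
  seq-ζ𝒫₄-summand k 0<k N i i≤2k = begin
    q * seq (ζ𝒫₄-summand k i) N
      ≡⟨ cong₂ (λ s t → q * ((e * d * (2^ (s ℤ.- ℤ.+ 1) - 1ℚ)) * z i * seq (ζ t) N)) (+4*k-2*i k i i≤2k) (4*k∸2*i k i) ⟩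
    q * ((e * d * d′) * z i * z j)
      ≡⟨ solve 6 (λ q e d d′ z z′ → q :* ((e :* d :* d′) :* z :* z′) := q :* (d :* d′) :* (e :* z :* z′)) refl q e d d′ (z i) (z j) ⟩
    q * (d * d′) * (e * z i * z j)
      ≡⟨ cong (_* (e * z i * z j)) (ζ𝒫₂-factor-* k 0<k i i≤2k) ⟨
    c * c′ * (e * z i * z j)
      ≡⟨ solve 5 (λ c c′ e z z′ → c :* c′ :* (e :* z :* z′) := e :* (c :* z) :* (c′ :* z′)) refl c c′ e (z i) (z j) ⟩
    e * (c * z i) * (c′ * z j)
      ∎
    where
      open ≡-Reasoning
      j  = 2 ℕ.* k ∸ i
      q  = 1/ 16 ^ℕ (k ∸ 1)
      z  = λ i → seq (ζ (2 ℕ.* i)) N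
      e  = [-1]^ i
      d  = 2^[2* i -1]-1
      d′ = 2^[2* j -1]-1
      c  = ζ𝒫₂-factor i
      c′ = ζ𝒫₂-factor j

  ζ𝒫₄ : ℕ → ℝ
  ζ𝒫₄ k = fromℚ (1/ 16 ^ℕ (k ∸ 1)) *ᴿ (Σᴿ[ 0 ⋯ 2 ℕ.* k ] ζ𝒫₄-summand k)

  -- No limit is involved: the recursive formula and the stated one have the same approximation at
  -- every index.
  seq-ζ𝒫₄ : ∀ k → 0 ℕ.< k → ∀ N → seq ⟦ ζ𝒫-formula 1 k ⟧ N ≡ seq (ζ𝒫₄ k) N
  seq-ζ𝒫₄ k 0<k N = trans (seq-convolutionᶠ a b (double k) N)
    (trans (cong (convolution (λ i → seq ⟦ a i ⟧ N) (λ i → seq ⟦ b i ⟧ N)) (double≡2* k))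
      (convolution≡seq-Σᴿ (1/ 16 ^ℕ (k ∸ 1)) (ζ𝒫₄-summand k) (2 ℕ.* k) N (seq-ζ𝒫₄-summand k 0<k N)))
    where
      a = signedᶠ (ζ𝒫-formula 0)
      b = ζ𝒫-formula 0

open import Data.Nat.Base using (ℕ; _∸_; _*_; _^_; _<_; suc)
open import Data.Integer.Base using (+_) renaming (_-_ to _-ᶻ_)
open import Data.Rational.Base using (1ℚ) renaming (_-_ to _-ℚ_; _*_ to _*ℚ_)
open import Data.Product.Base using (_×_; _,_; ∃-syntax)
open import Relation.Binary.PropositionalEquality using (refl)
open Asymptotics using (∼-resp-≗)
open SumsOverPartitions using (h∼⇒ζ𝒫)
open Evaluation using (ζ𝒫-formula; h∼ζ𝒫-formula; ζ𝒫₄; seq-ζ𝒫₄)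

corollary2p5 : (∀ k → 0 < k →
    ζ𝒫[ 4 ]^ k ≡
    (fromℚ (1/ 16 ^ℕ (k ∸ 1)) *ᴿ
    (Σᴿ[ 0 ⋯ 2 * k ] λ n →
    fromℚ ([-1]^ n *ℚ (2^ (+ (2 * n) -ᶻ + 1) -ℚ 1ℚ) *ℚ (2^ (+ (4 * k) -ᶻ + (2 * n) -ᶻ + 1) -ℚ 1ℚ))
    *ᴿ ζ (2 * n) *ᴿ ζ (4 * k ∸ 2 * n))))
    × (∀ t → 0 < t → ∀ k → 0 < k → ∃[ e ] ζ𝒫[ 2 ^ t ]^ k ≡ ⟦ e ⟧)
corollary2p5 =
  -- The index of `ζ𝒫-formula` is one less than the power of 2, and 4 = 2².
  (λ k 0<k → h∼⇒ζ𝒫 4 k (ζ𝒫₄ k) (∼-resp-≗ (λ _ → refl) (seq-ζ𝒫₄ k 0<k) (h∼ζ𝒫-formula 1 k))) ,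
  λ { (suc t) _ k _ → ζ𝒫-formula t k , h∼⇒ζ𝒫 (2 ^ suc t) k ⟦ ζ𝒫-formula t k ⟧ (h∼ζ𝒫-formula t k) }
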